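{- Let $n\geq 2$ be an integer. For integers $\ell\geq 1$ let $N_\ell(m)$ and $\Delta_\ell(n)=N_\ell(n)^2-N_\ell(n-1)N_\ell(n+1)$ be as in the context. (i) If $n\equiv 0\pmod 3$, then $\Delta_\ell(n)\geq 0$ for all but finitely many $\ell$. (ii) If $n\equiv 1\pmod 3$, then $\Delta_\ell(n)<0$ for all but finitely many $\ell$. (iii) If $n\equiv 2\pmod 3$ and $n<20$, then $\Delta_\ell(n)\geq 0$ for all but finitely many $\ell$; if $n\equiv 2\pmod 3$ and $n\geq 20$, then $\Delta_\ell(n)<0$ for all but finitely many $\ell$.
   Context: For integers $\ell\geq 1$ and $n\geq 1$, let $S_n$ be the symmetric group on $n$ letters and $C_{\ell,n}=\{(\pi_1,\dots,\pi_\ell)\in S_n^\ell : \pi_j\pi_k=\pi_k\pi_j \text{ for all } 1\le j,k\le \ell\}$. Put $N_\ell(n)=|C_{\ell,n}|/|S_n|=|C_{\ell,n}|/n!$ (a positive integer), and $N_\ell(0)=1$. Define $\Delta_\ell(n)=N_\ell(n)^2-N_\ell(n-1)N_\ell(n+1)$. The sequence is called log-concave at $n$ for $\ell$ if $\Delta_\ell(n)\ge 0$ and strictly log-convex at $n$ for $\ell$ if $\Delta_\ell(n)<0$. -}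

module Defs where

open import Data.Nat using (ℕ; zero; suc; _!; _/_; _*_; _+_; _≤_; pred)
open import Data.Nat.Properties using (_!≢0)
open import Data.Fin using (Fin)
import Data.Fin as F
open import Data.Bool using (Bool; true; false; _∧_; _∨_; not)
open import Data.List using (List; []; _∷_; [_]; map; concatMap; allFin; filterᵇ; length)
open import Data.Bool.ListAction using (all)
open import Data.Vec using (Vec; lookup; tabulate)
import Data.Vec as V
open import Data.Integer using (ℤ; +_; _-_)
open import Data.Product using (∃; _×_)
open import Relation.Nullary.Decidable using (does)

vecsOf : {A : Set} → (k : ℕ) → List A → List (Vec A k)
vecsOf zero    xs = [ V.[] ]
vecsOf (suc k) xs = concatMap (λ x → map (x V.∷_) (vecsOf k xs)) xs

Map : ℕ → Set
Map n = Vec (Fin n) n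

_≟ᵇ_ : {n : ℕ} → Fin n → Fin n → Bool
i ≟ᵇ j = does (i F.≟ j)

isPerm : {n : ℕ} → Map n → Bool
isPerm {n} σ = all (λ i → all (λ j → not (lookup σ i ≟ᵇ lookup σ j) ∨ (i ≟ᵇ j)) (allFin n)) (allFin n)

Sym : (n : ℕ) → List (Map n)
Sym n = filterᵇ isPerm (vecsOf n (allFin n))

_∘ₚ_ : {n : ℕ} → Map n → Map n → Map n
σ ∘ₚ τ = tabulate (λ i → lookup σ (lookup τ i))

eqMap : {n : ℕ} → Map n → Map n → Bool
eqMap {n} σ τ = all (λ i → lookup σ i ≟ᵇ lookup τ i) (allFin n)

commuteᵇ : {n : ℕ} → Map n → Map n → Bool
commuteᵇ σ τ = eqMap (σ ∘ₚ τ) (τ ∘ₚ σ)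

pairwiseCommute : {n ℓ : ℕ} → Vec (Map n) ℓ → Bool
pairwiseCommute {n} {ℓ} t =
  all (λ j → all (λ k → commuteᵇ (lookup t j) (lookup t k)) (allFin ℓ)) (allFin ℓ)

C : (ℓ n : ℕ) → List (Vec (Map n) ℓ)
C ℓ n = filterᵇ pairwiseCommute (vecsOf ℓ (Sym n))

-- N_ℓ(n) = |C_{ℓ,n}| / n!   (N_ℓ(0) = 1 automatically: S_0 has one element)
N : (ℓ n : ℕ) → ℕ
N ℓ n = (length (C ℓ n) / n !) {{n !≢0}}

-- Δ_ℓ(n) = N_ℓ(n)^2 - N_ℓ(n-1) N_ℓ(n+1), as an integer (used for n ≥ 1)
Δ : (ℓ n : ℕ) → ℤ
Δ ℓ n = + (N ℓ n * N ℓ n) - + (N ℓ (pred n) * N ℓ (suc n))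

Cofinitely : (ℕ → Set) → Set
Cofinitely P = ∃ λ L → ∀ ℓ → L ≤ ℓ → P ℓ

{-# OPTIONS --safe #-}

-- A commuting ℓ-tuple is an action of ℤ^ℓ.  Splitting off the orbit of the first point gives, for
-- h(n) = |C_{ℓ,n}| and the numbers t(k) of transitive tuples on k points,
--   h(n+1) = Σ_k binom(n, k-1) t(k) h(n+1-k).
-- A transitive tuple lies in its centralizer, which has at most k elements, so t(k) = O(k^ℓ), while
-- t(2) = X - 1, t(3) = Y - 1 and t(4) = 4X² - 6X + 2 for X = 2^ℓ and Y = 3^ℓ.  As k ≤ 3^(k/3), with the quotient
-- at most 5/3^(5/3) unless k is 2, 3 or 4, up to that relative error h(n) is a polynomial in X and Y, homogeneous of
-- weight n when X has weight 2 and Y weight 3.  In it, consecutive monomials differ by the factor X³/Y² = (8/9)^ℓ;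
-- the error absorbs all of them but the first two.  Comparing the two-term expansions of
-- (n+1) (n! N(n))² and n (n-1)! N(n-1) (n+1)! N(n+1) decides the sign of Δ: by the exponents if n ≡ 0, 1 (mod 3), by
-- the leading coefficients, in the ratio 6 (m+1) : 7m, if n = 3m + 2 ≠ 20, and by the second coefficients if n = 20.

module Submission where

open import Defs
open import Data.Bool using (Bool; true; false; T; T?; _∨_; not; if_then_else_)
open import Data.Bool.ListAction using (all)
open import Data.Empty using (⊥-elim)
open import Data.Fin using (Fin; zero; suc)
import Data.Fin as F
import Data.Fin.Properties as FP
open import Data.Integer using (0ℤ)
import Data.Integer as ℤ
import Data.Integer.Properties as ℤP
open import Data.List using (List; []; _∷_; map; concatMap; allFin; filterᵇ; filter; length; _++_; cartesianProductWith)
open import Data.List.Membership.Propositional using (_∈_; find; lose)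
open import Data.List.Membership.Propositional.Properties
import Data.List.Membership.DecPropositional as DecMem
open import Data.List.Properties using (length-++; length-map; length-tabulate; length-filter; filter-complete; map-++; map-∘; map-cong; ≡-dec)
open import Data.List.Relation.Unary.All as All using (All; []; _∷_)
import Data.List.Relation.Unary.All.Properties as AllP
open import Data.List.Relation.Unary.AllPairs using ([]; _∷_)
open import Data.List.Relation.Unary.Any using (here; there)
open import Data.List.Relation.Unary.Unique.Propositional using (Unique)
import Data.List.Relation.Unary.Unique.Propositional.Properties as UP
open import Data.Nat
open import Data.Nat.DivMod using (m≡m%n+[m/n]*n; m%n<n)
open import Data.Nat.Induction using (<-rec)
open import Data.Nat.ListAction using (sum)
open import Data.Nat.ListAction.Properties using (sum-++)
open import Data.Nat.Properties
open import Data.Nat.Tactic.RingSolver using (solve-∀)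
open import Data.Product using (_×_; _,_; proj₁; proj₂; ∃)
open import Data.Sum using (_⊎_; inj₁; inj₂)
import Data.Sum as Sum
import Data.Sum.Properties as SumP
open import Data.Vec using (Vec; lookup; tabulate; []; _∷_)
import Data.Vec.Properties as VP
open import Data.Vec.Relation.Binary.Pointwise.Extensional using (ext; Pointwise-≡⇒≡)
open import Function using (_∘_; id)
open import Relation.Binary.PropositionalEquality
open import Relation.Nullary using (Dec; yes; no; does; ¬_)
open import Relation.Nullary.Decidable using (map′; toWitness; _×-dec_; _⊎-dec_; _→-dec_)
open import Relation.Unary using (Decidable)

-- Counting with duplicate-free lists

-- One unit of weight stands for the irrational rate 3^(1/3), so sizes are compared through their
-- cubes and the comparisons reduce to inequalities between numerals. Measured against its weight, Y
-- does not decay, while X^j decays at the rate (2/3^(2/3))^j. The error rate 5/3^(5/3) = 0.801...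
-- lies between the fifth power 0.821... and the sixth 0.790..., so exactly the exponents of X up to
-- 5 are visible. In a fixed weight these exponents form one class modulo 3, which leaves two
-- monomials both for each h(n) and for each product of two of them. This is just enough to resolve
-- the tie at n = 20. Orbits of size 4 cannot be neglected, since 4^ℓ = X² is as large as the
-- contribution of two orbits of size 2. Their number is obtained without classifying transitive
-- actions: h(4) is computed through centralizers in S₄, and the recursion is solved for t(4). N is
-- an integer quotient by n!; the remainder of the division is bounded in ℓ and falls under the same
-- error.

∈-∷⁻ : {A : Set} {x y : A} {xs : List A} → y ∈ x ∷ xs → y ≢ x → y ∈ xs
∈-∷⁻ (here eq) neq = ⊥-elim (neq eq)
∈-∷⁻ (there m) _   = m

∈-remove : {A : Set} {x y : A} (as : List A) {bs : List A} → y ∈ as ++ x ∷ bs → y ≢ x → y ∈ as ++ bs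
∈-remove as m neq with ∈-++⁻ as m
... | inj₁ p = ∈-++⁺ˡ p
... | inj₂ p = ∈-++⁺ʳ as (∈-∷⁻ p neq)

Unique-⊆⇒length≤ : {A : Set} {xs ys : List A} → Unique xs → (∀ {x} → x ∈ xs → x ∈ ys) → length xs ≤ length ys
Unique-⊆⇒length≤ [] sub = z≤n
Unique-⊆⇒length≤ {xs = x ∷ xs} (x∉ ∷ u) sub with ∈-∃++ (sub (here refl))
... | as , bs , refl = begin
  suc (length xs)             ≤⟨ s≤s (Unique-⊆⇒length≤ u λ m → ∈-remove as (sub (there m)) λ { refl → All.lookup x∉ m refl }) ⟩
  suc (length (as ++ bs))     ≡⟨ cong suc (length-++ as) ⟩
  suc (length as + length bs) ≡⟨ +-suc (length as) _ ⟨
  length as + suc (length bs) ≡⟨ length-++ as ⟨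
  length (as ++ x ∷ bs)       ∎
  where open ≤-Reasoning

Unique-⇔⇒length≡ : {A : Set} {xs ys : List A} → Unique xs → Unique ys →
  (∀ {x} → x ∈ xs → x ∈ ys) → (∀ {x} → x ∈ ys → x ∈ xs) → length xs ≡ length ys
Unique-⇔⇒length≡ u v f g = ≤-antisym (Unique-⊆⇒length≤ u f) (Unique-⊆⇒length≤ v g)

∈-concatMap⁺′ : {A B : Set} (f : A → List B) {xs : List A} {x : A} {y : B} → x ∈ xs → y ∈ f x → y ∈ concatMap f xs
∈-concatMap⁺′ f m p = ∈-concatMap⁺ f (lose m p)

∈-concatMap⁻′ : {A B : Set} (f : A → List B) {xs : List A} {y : B} → y ∈ concatMap f xs → ∃ λ x → x ∈ xs × y ∈ f x
∈-concatMap⁻′ f m = find (∈-concatMap⁻ f m)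

Unique-concatMap : {A B : Set} (f : A → List B) {xs : List A} → Unique xs → (∀ {x} → x ∈ xs → Unique (f x)) →
  (∀ {x x′ y} → x ∈ xs → x′ ∈ xs → y ∈ f x → y ∈ f x′ → x ≡ x′) → Unique (concatMap f xs)
Unique-concatMap f [] _ _ = []
Unique-concatMap f (x∉ ∷ u) uf key = UP.++⁺ (uf (here refl))
  (Unique-concatMap f u (uf ∘ there) λ p q → key (there p) (there q))
  λ (p , q) → let x′ , m , r = ∈-concatMap⁻′ f q in All.lookup x∉ m (key (here refl) (there m) p r)

length-concatMap : {A B : Set} (f : A → List B) (xs : List A) → length (concatMap f xs) ≡ sum (map (length ∘ f) xs)
length-concatMap f []       = refl
length-concatMap f (x ∷ xs) = trans (length-++ (f x)) (cong (length (f x) +_) (length-concatMap f xs))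

length-cartesianProductWith : {A B D : Set} (f : A → B → D) (xs : List A) (ys : List B) →
  length (cartesianProductWith f xs ys) ≡ length xs * length ys
length-cartesianProductWith f []       ys = refl
length-cartesianProductWith f (x ∷ xs) ys = trans (length-++ (map (f x) ys))
  (cong₂ _+_ (length-map (f x) ys) (length-cartesianProductWith f xs ys))

-- Enumerating commuting tuples

∈-vecsOf⁺ : {A : Set} {k : ℕ} {xs : List A} (v : Vec A k) → (∀ i → lookup v i ∈ xs) → v ∈ vecsOf k xs
∈-vecsOf⁺ []      _ = here refl
∈-vecsOf⁺ (x ∷ v) m = ∈-concatMap⁺′ _ (m zero) (∈-map⁺ (x ∷_) (∈-vecsOf⁺ v (m ∘ suc)))

∈-vecsOf⁻ : {A : Set} {k : ℕ} {xs : List A} {v : Vec A k} → v ∈ vecsOf k xs → ∀ i → lookup v i ∈ xs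
∈-vecsOf⁻ {k = suc k} {xs} m i with ∈-concatMap⁻′ (λ x → map (x ∷_) (vecsOf k xs)) {xs} m
... | x , x∈ , p with ∈-map⁻ (x ∷_) p
∈-vecsOf⁻ m zero    | x , x∈ , p | w , w∈ , refl = x∈
∈-vecsOf⁻ m (suc i) | x , x∈ , p | w , w∈ , refl = ∈-vecsOf⁻ w∈ i

Unique-vecsOf : {A : Set} (k : ℕ) {xs : List A} → Unique xs → Unique (vecsOf k xs)
Unique-vecsOf zero    u = [] ∷ []
Unique-vecsOf (suc k) u = Unique-concatMap (λ x → map (x ∷_) (vecsOf k _)) u
  (λ _ → UP.map⁺ VP.∷-injectiveʳ (Unique-vecsOf k u))
  λ {x} {x′} _ _ p q → let _ , _ , e = ∈-map⁻ (x ∷_) p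
                           _ , _ , f = ∈-map⁻ (x′ ∷_) q
                       in VP.∷-injectiveˡ (trans (sym e) f)

length-vecsOf : {A : Set} (k : ℕ) (xs : List A) → length (vecsOf k xs) ≡ length xs ^ k
length-vecsOf zero    xs = refl
length-vecsOf (suc k) xs = trans (length-concatMap (λ x → map (x ∷_) (vecsOf k xs)) xs) (go xs)
  where
  go : ∀ ys → sum (map (λ x → length (map (x ∷_) (vecsOf k xs))) ys) ≡ length ys * length xs ^ k
  go []       = refl
  go (y ∷ ys) = cong₂ _+_ (trans (length-map (y ∷_) (vecsOf k xs)) (length-vecsOf k xs)) (go ys)

does⁺ : {P : Set} (P? : Dec P) → P → T (does P?)
does⁺ (yes _) _ = _
does⁺ (no ¬p) p = ¬p p

does⁻ : {P : Set} (P? : Dec P) → T (does P?) → P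
does⁻ (yes p) _ = p

all-allFin⁺ : ∀ {n} {p : Fin n → Bool} → (∀ i → T (p i)) → T (all p (allFin n))
all-allFin⁺ {n} {p} h = AllP.all⁻ p {xs = allFin n} (All.tabulate λ {i} _ → h i)

all-allFin⁻ : ∀ {n} {p : Fin n → Bool} → T (all p (allFin n)) → ∀ i → T (p i)
all-allFin⁻ {p = p} h i = All.lookup (AllP.all⁺ p (allFin _) h) (∈-allFin i)

Inj : ∀ {n} → Map n → Set
Inj σ = ∀ {i j} → lookup σ i ≡ lookup σ j → i ≡ j

Comm : ∀ {n} → Map n → Map n → Set
Comm σ τ = ∀ y → lookup σ (lookup τ y) ≡ lookup τ (lookup σ y)

record Good {n ℓ} (π : Vec (Map n) ℓ) : Set where
  constructor good
  field
    inj : ∀ j → Inj (lookup π j)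
    com : ∀ j k → Comm (lookup π j) (lookup π k)

open Good

impᵇ⁺ : ∀ {P Q : Set} (P? : Dec P) (Q? : Dec Q) → (P → Q) → T (not (does P?) ∨ does Q?)
impᵇ⁺ (yes p) Q? h = does⁺ Q? (h p)
impᵇ⁺ (no _)  Q? h = _

impᵇ⁻ : ∀ {P Q : Set} (P? : Dec P) (Q? : Dec Q) → T (not (does P?) ∨ does Q?) → P → Q
impᵇ⁻ (yes _) Q? h _ = does⁻ Q? h
impᵇ⁻ (no ¬p) Q? h p = ⊥-elim (¬p p)

∈-Sym⁺ : ∀ {n} {σ : Map n} → Inj σ → σ ∈ Sym n
∈-Sym⁺ {n} {σ} inj = ∈-filter⁺ (T? ∘ isPerm) (∈-vecsOf⁺ σ λ i → ∈-allFin _)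
  (all-allFin⁺ λ i → all-allFin⁺ λ j → impᵇ⁺ (lookup σ i F.≟ lookup σ j) (i F.≟ j) inj)

∈-Sym⁻ : ∀ {n} {σ : Map n} → σ ∈ Sym n → Inj σ
∈-Sym⁻ {n} {σ} m {i} {j} = impᵇ⁻ (lookup σ i F.≟ lookup σ j) (i F.≟ j)
  (all-allFin⁻ (all-allFin⁻ (proj₂ (∈-filter⁻ (T? ∘ isPerm) {xs = vecsOf n (allFin n)} m)) i) j)

Unique-Sym : ∀ n → Unique (Sym n)
Unique-Sym n = UP.filter⁺ (T? ∘ isPerm) (Unique-vecsOf n (UP.allFin⁺ n))

commuteᵇ⁺ : ∀ {n} {σ τ : Map n} → Comm σ τ → T (commuteᵇ σ τ)
commuteᵇ⁺ {σ = σ} {τ} c = all-allFin⁺ λ i →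
  does⁺ (_ F.≟ _) (trans (VP.lookup∘tabulate _ i) (trans (c i) (sym (VP.lookup∘tabulate (lookup τ ∘ lookup σ) i))))

commuteᵇ⁻ : ∀ {n} {σ τ : Map n} → T (commuteᵇ σ τ) → Comm σ τ
commuteᵇ⁻ {σ = σ} {τ} c i =
  trans (sym (VP.lookup∘tabulate _ i)) (trans (does⁻ (_ F.≟ _) (all-allFin⁻ c i)) (VP.lookup∘tabulate (lookup τ ∘ lookup σ) i))

pairwiseCommute⁺ : ∀ {n ℓ} {π : Vec (Map n) ℓ} → (∀ j k → Comm (lookup π j) (lookup π k)) → T (pairwiseCommute π)
pairwiseCommute⁺ {π = π} c = all-allFin⁺ λ j → all-allFin⁺ λ k → commuteᵇ⁺ {σ = lookup π j} {lookup π k} (c j k)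

pairwiseCommute⁻ : ∀ {n ℓ} {π : Vec (Map n) ℓ} → T (pairwiseCommute π) → ∀ j k → Comm (lookup π j) (lookup π k)
pairwiseCommute⁻ {π = π} c j k = commuteᵇ⁻ {σ = lookup π j} {lookup π k} (all-allFin⁻ (all-allFin⁻ c j) k)

commuting : ∀ {n} (ℓ : ℕ) → List (Map n) → List (Vec (Map n) ℓ)
commuting ℓ cs = filterᵇ pairwiseCommute (vecsOf ℓ cs)

∈-commuting⁺ : ∀ {n ℓ} {cs : List (Map n)} (π : Vec (Map n) ℓ) → (∀ j → lookup π j ∈ cs) →
  (∀ j k → Comm (lookup π j) (lookup π k)) → π ∈ commuting ℓ cs
∈-commuting⁺ π m c = ∈-filter⁺ (T? ∘ pairwiseCommute) (∈-vecsOf⁺ π m) (pairwiseCommute⁺ {π = π} c)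

∈-commuting⁻ : ∀ {n ℓ} {cs : List (Map n)} (π : Vec (Map n) ℓ) → π ∈ commuting ℓ cs →
  (∀ j → lookup π j ∈ cs) × (∀ j k → Comm (lookup π j) (lookup π k))
∈-commuting⁻ {ℓ = ℓ} {cs} π m = let v , c = ∈-filter⁻ (T? ∘ pairwiseCommute) {xs = vecsOf ℓ cs} m in
  ∈-vecsOf⁻ v , pairwiseCommute⁻ {π = π} c

Unique-commuting : ∀ {n} ℓ {cs : List (Map n)} → Unique cs → Unique (commuting ℓ cs)
Unique-commuting ℓ u = UP.filter⁺ (T? ∘ pairwiseCommute) (Unique-vecsOf ℓ u)

∈-C⁺ : ∀ {n ℓ} {π : Vec (Map n) ℓ} → Good π → π ∈ C ℓ n
∈-C⁺ {π = π} (good inj com) = ∈-commuting⁺ π (λ j → ∈-Sym⁺ (inj j)) com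

∈-C⁻ : ∀ {n ℓ} {π : Vec (Map n) ℓ} → π ∈ C ℓ n → Good π
∈-C⁻ {π = π} m = let v , c = ∈-commuting⁻ π m in good (λ j → ∈-Sym⁻ (v j)) c

Unique-C : ∀ ℓ n → Unique (C ℓ n)
Unique-C ℓ n = Unique-commuting ℓ (Unique-Sym n)

vec-ext : {A : Set} {n : ℕ} {v w : Vec A n} → (∀ i → lookup v i ≡ lookup w i) → v ≡ w
vec-ext h = Pointwise-≡⇒≡ (ext h)

-- Bit vectors and the splittings they define

bits : (n : ℕ) → List (Vec Bool n)
bits zero    = [] ∷ []
bits (suc n) = map (true ∷_) (bits n) ++ map (false ∷_) (bits n)

∈-bits : ∀ {n} (v : Vec Bool n) → v ∈ bits n
∈-bits []          = here refl
∈-bits (true ∷ v)  = ∈-++⁺ˡ (∈-map⁺ (true ∷_) (∈-bits v))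
∈-bits (false ∷ v) = ∈-++⁺ʳ _ (∈-map⁺ (false ∷_) (∈-bits v))

Unique-bits : ∀ n → Unique (bits n)
Unique-bits zero    = [] ∷ []
Unique-bits (suc n) = UP.++⁺ (UP.map⁺ VP.∷-injectiveʳ (Unique-bits n)) (UP.map⁺ VP.∷-injectiveʳ (Unique-bits n))
  λ (p , q) → case-∷ (∈-map⁻ (true ∷_) p) (∈-map⁻ (false ∷_) q)
  where
  case-∷ : ∀ {v : Vec Bool (suc n)} → ∃ (λ x → x ∈ bits n × v ≡ true ∷ x) → ∃ (λ x → x ∈ bits n × v ≡ false ∷ x) → _
  case-∷ (_ , _ , e) (_ , _ , f) with VP.∷-injectiveˡ (trans (sym e) f)
  ... | ()

allBits? : ∀ {n} {P : Vec Bool n → Set} → (∀ v → Dec (P v)) → Dec (∀ v → P v)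
allBits? {zero}  P? = map′ (λ { p [] → p }) (λ h → h []) (P? [])
allBits? {suc n} P? = map′ (λ { (p , q) (true ∷ v) → p v ; (p , q) (false ∷ v) → q v })
  (λ h → h ∘ (true ∷_) , h ∘ (false ∷_)) (allBits? (P? ∘ (true ∷_)) ×-dec allBits? (P? ∘ (false ∷_)))

-- By recursion on the vector `#t (true ∷ v)` reduces to `suc (#t v)`, so the part that contains
-- zero is nonempty by definition, as `Transitive` requires.
#t #f : ∀ {n} → Vec Bool n → ℕ
#t []          = 0
#t (true ∷ v)  = suc (#t v)
#t (false ∷ v) = #t v
#f []          = 0
#f (true ∷ v)  = #f v
#f (false ∷ v) = suc (#f v)

to : ∀ {n} (v : Vec Bool n) → Fin n → Fin (#t v) ⊎ Fin (#f v)
to (true ∷ v)  zero    = inj₁ zero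
to (false ∷ v) zero    = inj₂ zero
to (true ∷ v)  (suc y) = Sum.map₁ suc (to v y)
to (false ∷ v) (suc y) = Sum.map₂ suc (to v y)

from : ∀ {n} (v : Vec Bool n) → Fin (#t v) ⊎ Fin (#f v) → Fin n
from (true ∷ v)  (inj₁ zero)    = zero
from (true ∷ v)  (inj₁ (suc a)) = suc (from v (inj₁ a))
from (true ∷ v)  (inj₂ b)       = suc (from v (inj₂ b))
from (false ∷ v) (inj₂ zero)    = zero
from (false ∷ v) (inj₂ (suc b)) = suc (from v (inj₂ b))
from (false ∷ v) (inj₁ a)       = suc (from v (inj₁ a))

from-to : ∀ {n} (v : Vec Bool n) y → from v (to v y) ≡ y
from-to (true ∷ v)  zero    = refl
from-to (false ∷ v) zero    = refl
from-to (true ∷ v)  (suc y) with to v y | from-to v y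
... | inj₁ a | e = cong suc e
... | inj₂ b | e = cong suc e
from-to (false ∷ v) (suc y) with to v y | from-to v y
... | inj₁ a | e = cong suc e
... | inj₂ b | e = cong suc e

to-from : ∀ {n} (v : Vec Bool n) s → to v (from v s) ≡ s
to-from (true ∷ v)  (inj₁ zero)    = refl
to-from (true ∷ v)  (inj₁ (suc a)) = cong (Sum.map₁ suc) (to-from v (inj₁ a))
to-from (true ∷ v)  (inj₂ b)       = cong (Sum.map₁ suc) (to-from v (inj₂ b))
to-from (false ∷ v) (inj₂ zero)    = refl
to-from (false ∷ v) (inj₂ (suc b)) = cong (Sum.map₂ suc) (to-from v (inj₂ b))
to-from (false ∷ v) (inj₁ a)       = cong (Sum.map₂ suc) (to-from v (inj₁ a))

from-injective : ∀ {n} (v : Vec Bool n) {s s′} → from v s ≡ from v s′ → s ≡ s′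
from-injective v e = trans (sym (to-from v _)) (trans (cong (to v) e) (to-from v _))

lookup-from₁ : ∀ {n} (v : Vec Bool n) a → T (lookup v (from v (inj₁ a)))
lookup-from₁ (true ∷ v)  zero    = _
lookup-from₁ (true ∷ v)  (suc a) = lookup-from₁ v a
lookup-from₁ (false ∷ v) a       = lookup-from₁ v a

lookup-from₂ : ∀ {n} (v : Vec Bool n) b → ¬ T (lookup v (from v (inj₂ b)))
lookup-from₂ (true ∷ v)  b       = lookup-from₂ v b
lookup-from₂ (false ∷ v) zero    = id
lookup-from₂ (false ∷ v) (suc b) = lookup-from₂ v b

view : ∀ {n} (v : Vec Bool n) y → ∃ λ s → y ≡ from v s
view v y = to v y , sym (from-to v y)

in₁ : ∀ {n} (v : Vec Bool n) {y} → T (lookup v y) → ∃ λ a → y ≡ from v (inj₁ a)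
in₁ v {y} t with view v y
... | inj₁ a , e    = a , e
... | inj₂ b , refl = ⊥-elim (lookup-from₂ v b t)

in₂ : ∀ {n} (v : Vec Bool n) {y} → ¬ T (lookup v y) → ∃ λ b → y ≡ from v (inj₂ b)
in₂ v {y} t with view v y
... | inj₂ b , e    = b , e
... | inj₁ a , refl = ⊥-elim (t (lookup-from₁ v a))

-- Tuples of maps, closed sets and orbits of zero

Tup : ℕ → ℕ → Set
Tup ℓ n = Vec (Map n) ℓ

act : ∀ {ℓ n} → Tup ℓ n → Fin ℓ → Fin n → Fin n
act π j = lookup (lookup π j)

tup-ext : ∀ {ℓ n} {π ρ : Tup ℓ n} → (∀ j y → act π j y ≡ act ρ j y) → π ≡ ρ
tup-ext h = vec-ext λ j → vec-ext (h j)

tup : ∀ {ℓ n} → (Fin ℓ → Fin n → Fin n) → Tup ℓ n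
tup f = tabulate λ j → tabulate (f j)

act-tup : ∀ {ℓ n} (f : Fin ℓ → Fin n → Fin n) j y → act (tup f) j y ≡ f j y
act-tup f j y = trans (cong (λ σ → lookup σ y) (VP.lookup∘tabulate _ j)) (VP.lookup∘tabulate (f j) y)

-- Closure under the maps alone suffices: on a finite set an injective map sends a closed set onto
-- itself. Sets are bit vectors, so a quantifier over all of them can be decided by search.
Closed : ∀ {ℓ n} → Vec Bool n → Tup ℓ n → Set
Closed V π = ∀ j y → T (lookup V y) → T (lookup V (act π j y))

closed? : ∀ {ℓ n} (V : Vec Bool n) (π : Tup ℓ n) → Dec (Closed V π)
closed? V π = FP.all? λ j → FP.all? λ y → T? _ →-dec T? _

Transitive : ∀ {ℓ n} → Tup ℓ (suc n) → Set
Transitive π = ∀ W → T (lookup W zero) → Closed W π → ∀ y → T (lookup W y)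

transitive? : ∀ {ℓ n} (π : Tup ℓ (suc n)) → Dec (Transitive π)
transitive? π = allBits? λ W → T? _ →-dec (closed? W π →-dec FP.all? λ y → T? _)

-- The orbit as the least closed set containing zero. Words in the generators never occur, and
-- minimality used in both directions gives uniqueness.
record IsOrbit {ℓ n} (V : Vec Bool (suc n)) (π : Tup ℓ (suc n)) : Set where
  constructor orbit
  field
    has-zero : T (lookup V zero)
    closed   : Closed V π
    minimal  : ∀ W → T (lookup W zero) → Closed W π → ∀ y → T (lookup V y) → T (lookup W y)

T-ext : ∀ {b c} → (T b → T c) → (T c → T b) → b ≡ c
T-ext {true}  {true}  _ _ = refl
T-ext {false} {false} _ _ = refl
T-ext {true}  {false} f _ = ⊥-elim (f _)
T-ext {false} {true}  _ g = ⊥-elim (g _)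

IsOrbit-unique : ∀ {ℓ n} {V W : Vec Bool (suc n)} {π : Tup ℓ (suc n)} → IsOrbit V π → IsOrbit W π → V ≡ W
IsOrbit-unique {V = V} {W} (orbit v₀ cv mv) (orbit w₀ cw mw) =
  vec-ext λ y → T-ext (mv W w₀ cw y) (mw V v₀ cv y)

module _ {n} {P : Fin n → Set} (P? : ∀ y → Dec (P y)) where

  toBits : Vec Bool n
  toBits = tabulate (does ∘ P?)

  toBits⁺ : ∀ {y} → P y → T (lookup toBits y)
  toBits⁺ {y} p = subst T (sym (VP.lookup∘tabulate _ y)) (does⁺ (P? y) p)

  toBits⁻ : ∀ {y} → T (lookup toBits y) → P y
  toBits⁻ {y} t = does⁻ (P? y) (subst T (VP.lookup∘tabulate _ y) t)

-- The orbit is the intersection of all closed sets containing zero; membership is decidable because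
-- there are finitely many of them.
orbit-exists : ∀ {ℓ n} (π : Tup ℓ (suc n)) → ∃ λ V → IsOrbit V π
orbit-exists {n = n} π = toBits In? , orbit (toBits⁺ In? {zero} λ W w₀ _ → w₀)
  (λ j y t → toBits⁺ In? λ W w₀ c → c j y (toBits⁻ In? t W w₀ c))
  (λ W w₀ c y t → toBits⁻ In? t W w₀ c)
  where
  In : Fin (suc n) → Set
  In y = ∀ W → T (lookup W zero) → Closed W π → T (lookup W y)
  In? : ∀ y → Dec (In y)
  In? y = allBits? λ W → T? _ →-dec (closed? W π →-dec T? _)

-- Gluing actions on the two parts of a splitting

glue : ∀ {ℓ n} (v : Vec Bool n) → Tup ℓ (#t v) → Tup ℓ (#f v) → Tup ℓ n
glue v σ τ = tup λ j y → from v (Sum.map (act σ j) (act τ j) (to v y))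

module _ {ℓ n} (v : Vec Bool n) (σ : Tup ℓ (#t v)) (τ : Tup ℓ (#f v)) where

  private π = glue v σ τ

  act-glue : ∀ j s → act π j (from v s) ≡ from v (Sum.map (act σ j) (act τ j) s)
  act-glue j s = trans (act-tup _ j _) (cong (from v ∘ Sum.map (act σ j) (act τ j)) (to-from v s))

  glue-good : Good σ → Good τ → Good π
  glue-good (good iσ cσ) (good iτ cτ) = good inj″ com″
    where
    inj′ : ∀ j s s′ → Sum.map (act σ j) (act τ j) s ≡ Sum.map (act σ j) (act τ j) s′ → s ≡ s′
    inj′ j (inj₁ a) (inj₁ a′) e = cong inj₁ (iσ j (SumP.inj₁-injective e))
    inj′ j (inj₂ b) (inj₂ b′) e = cong inj₂ (iτ j (SumP.inj₂-injective e))
    inj″ : ∀ j → Inj (lookup π j)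
    inj″ j {x} {y} e with view v x | view v y
    ... | s , refl | s′ , refl = cong (from v) (inj′ j s s′ (from-injective v
          (trans (sym (act-glue j s)) (trans e (act-glue j s′)))))
    com′ : ∀ j k s → Sum.map (act σ j) (act τ j) (Sum.map (act σ k) (act τ k) s) ≡
                     Sum.map (act σ k) (act τ k) (Sum.map (act σ j) (act τ j) s)
    com′ j k (inj₁ a) = cong inj₁ (cσ j k a)
    com′ j k (inj₂ b) = cong inj₂ (cτ j k b)
    twice : ∀ j k s → act π j (act π k (from v s)) ≡
      from v (Sum.map (act σ j) (act τ j) (Sum.map (act σ k) (act τ k) s))
    twice j k s = trans (cong (act π j) (act-glue k s)) (act-glue j _)
    com″ : ∀ j k → Comm (lookup π j) (lookup π k)
    com″ j k y with view v y
    ... | s , refl = trans (twice j k s) (trans (cong (from v) (com′ j k s)) (sym (twice k j s)))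

  glue-closed : Closed v π
  glue-closed j y t with in₁ v t
  ... | a , refl = subst (T ∘ lookup v) (sym (act-glue j (inj₁ a))) (lookup-from₁ v _)

glue-orbit : ∀ {ℓ n} (v : Vec Bool n) (σ : Tup ℓ (suc (#t v))) (τ : Tup ℓ (#f v)) →
  Transitive σ → IsOrbit (true ∷ v) (glue (true ∷ v) σ τ)
glue-orbit v σ τ tr = orbit _ (glue-closed w σ τ) minimal
  where
  w = true ∷ v
  minimal : ∀ W → T (lookup W zero) → Closed W (glue w σ τ) → ∀ y → T (lookup w y) → T (lookup W y)
  minimal W w₀ c y t with in₁ w {y} t
  -- `W` is pulled back along the numbering of the first part. The pullback is closed under `σ`, so
  -- transitivity makes it everything.
  ... | a , refl = toBits⁻ In? (tr (toBits In?) (toBits⁺ In? {zero} w₀) closed a)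
    where
    In? = λ a → T? (lookup W (from w (inj₁ a)))
    closed : Closed (toBits In?) σ
    closed j b t = toBits⁺ In? (subst (T ∘ lookup W) (act-glue w σ τ j (inj₁ b)) (c j _ (toBits⁻ In? t)))

glue-injective : ∀ {ℓ n} (v : Vec Bool n) {σ σ′ : Tup ℓ (#t v)} {τ τ′ : Tup ℓ (#f v)} →
  glue v σ τ ≡ glue v σ′ τ′ → σ ≡ σ′ × τ ≡ τ′
glue-injective v {σ} {σ′} {τ} {τ′} e =
  tup-ext {π = σ} (λ j a → SumP.inj₁-injective (same j (inj₁ a))) ,
  tup-ext {π = τ} (λ j b → SumP.inj₂-injective (same j (inj₂ b)))
  where
  same : ∀ j s → Sum.map (act σ j) (act τ j) s ≡ Sum.map (act σ′ j) (act τ′ j) s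
  same j s = from-injective v {Sum.map (act σ j) (act τ j) s} {Sum.map (act σ′ j) (act τ′ j) s} (trans (sym (act-glue v σ τ j s))
    (trans (cong (λ π → act π j (from v s)) e) (act-glue v σ′ τ′ j s)))

-- A missed value could be punched out of the codomain, leaving an injection into a smaller finite
-- set.
injective⇒surjective : ∀ {n} (f : Fin n → Fin n) → (∀ {x y} → f x ≡ f y → x ≡ y) → ∀ y → ∃ λ x → f x ≡ y
injective⇒surjective {suc n} f inj y with FP.any? (λ x → f x F.≟ y)
... | yes p = p
... | no ¬p = ⊥-elim (FP.<⇒notInjective (n<1+n n)
  λ {i} {j} e → inj (FP.punchOut-injective (λ q → ¬p (i , sym q)) (λ q → ¬p (j , sym q)) e))

module _ {ℓ n} (v : Vec Bool n) (π : Tup ℓ n) (g : Good π) (c : Closed v π) where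

  private abstract
    left : ∀ j a → ∃ λ b → act π j (from v (inj₁ a)) ≡ from v (inj₁ b)
    left j a = in₁ v (c j _ (lookup-from₁ v a))

    left-injective : ∀ j {a b} → proj₁ (left j a) ≡ proj₁ (left j b) → a ≡ b
    left-injective j {a} {b} e = SumP.inj₁-injective (from-injective v (inj g j
      (trans (proj₂ (left j a)) (trans (cong (from v ∘ inj₁) e) (sym (proj₂ (left j b)))))))

    -- The map is injective on the closed part, hence permutes it. A point outside with its image
    -- inside would share that image with a point inside.
    co-closed : ∀ j b → ¬ T (lookup v (act π j (from v (inj₂ b))))
    co-closed j b t with in₁ v t
    ... | a , e with injective⇒surjective (proj₁ ∘ left j) (left-injective j) a
    ... | a′ , f with from-injective v {inj₁ a′} {inj₂ b} (inj g j
        (trans (proj₂ (left j a′)) (trans (cong (from v ∘ inj₁) f) (sym e))))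
    ... | ()

    right : ∀ j b → ∃ λ b′ → act π j (from v (inj₂ b)) ≡ from v (inj₂ b′)
    right j b = in₂ v (co-closed j b)

  restrict₁ : Tup ℓ (#t v)
  restrict₁ = tup λ j a → proj₁ (left j a)

  restrict₂ : Tup ℓ (#f v)
  restrict₂ = tup λ j b → proj₁ (right j b)

  act-restrict₁ : ∀ j a → act π j (from v (inj₁ a)) ≡ from v (inj₁ (act restrict₁ j a))
  act-restrict₁ j a = trans (proj₂ (left j a)) (cong (from v ∘ inj₁) (sym (act-tup _ j a)))

  act-restrict₂ : ∀ j b → act π j (from v (inj₂ b)) ≡ from v (inj₂ (act restrict₂ j b))
  act-restrict₂ j b = trans (proj₂ (right j b)) (cong (from v ∘ inj₂) (sym (act-tup _ j b)))

  glue-restrict : glue v restrict₁ restrict₂ ≡ π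
  glue-restrict = tup-ext {π = glue v restrict₁ restrict₂} same
    where
    same : ∀ j y → act (glue v restrict₁ restrict₂) j y ≡ act π j y
    same j y with view v y
    ... | inj₁ a , refl = trans (act-glue v restrict₁ restrict₂ j _) (sym (act-restrict₁ j a))
    ... | inj₂ b , refl = trans (act-glue v restrict₁ restrict₂ j _) (sym (act-restrict₂ j b))

  restrict₁-good : Good restrict₁
  restrict₁-good = good (λ j {a} {b} e → SumP.inj₁-injective (from-injective v (inj g j
      (trans (act-restrict₁ j a) (trans (cong (from v ∘ inj₁) e) (sym (act-restrict₁ j b)))))))
    λ j k a → SumP.inj₁-injective (from-injective v (trans (sym (twice j k a))
      (trans (com g j k _) (twice k j a))))
    where
    twice : ∀ j k a → act π j (act π k (from v (inj₁ a))) ≡ from v (inj₁ (act restrict₁ j (act restrict₁ k a)))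
    twice j k a = trans (cong (act π j) (act-restrict₁ k a)) (act-restrict₁ j _)

  restrict₂-good : Good restrict₂
  restrict₂-good = good (λ j {a} {b} e → SumP.inj₂-injective (from-injective v (inj g j
      (trans (act-restrict₂ j a) (trans (cong (from v ∘ inj₂) e) (sym (act-restrict₂ j b)))))))
    λ j k a → SumP.inj₂-injective (from-injective v (trans (sym (twice j k a))
      (trans (com g j k _) (twice k j a))))
    where
    twice : ∀ j k a → act π j (act π k (from v (inj₂ a))) ≡ from v (inj₂ (act restrict₂ j (act restrict₂ k a)))
    twice j k a = trans (cong (act π j) (act-restrict₂ k a)) (act-restrict₂ j _)

-- The image of `W` in the full set contains zero and is closed under `π`, so by minimality it
-- contains the whole orbit.
restrict-transitive : ∀ {ℓ n} (v : Vec Bool n) (π : Tup ℓ (suc n)) (g : Good π) (o : IsOrbit (true ∷ v) π) →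
  Transitive (restrict₁ (true ∷ v) π g (IsOrbit.closed o))
restrict-transitive {n = n} v π g (orbit _ c minimal) W w₀ cW a =
  let a′ , e , t = toBits⁻ In? {from w (inj₁ a)} (minimal (toBits In?) (toBits⁺ In? (zero , refl , w₀)) closed (from w (inj₁ a)) (lookup-from₁ w a))
  in subst (T ∘ lookup W) (SumP.inj₁-injective (from-injective w {inj₁ a′} {inj₁ a} (sym e))) t
  where
  w = true ∷ v
  σ = restrict₁ w π g c
  In : Fin (suc n) → Set
  In y = ∃ λ a → y ≡ from w (inj₁ a) × T (lookup W a)
  In? : ∀ y → Dec (In y)
  In? y = FP.any? λ a → (y F.≟ from w (inj₁ a)) ×-dec T? _
  closed : Closed (toBits In?) π
  closed j y t with toBits⁻ In? {y} t
  ... | a , refl , ta = toBits⁺ In? (act σ j a , act-restrict₁ w π g c j a , cW j a ta)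

-- The recursion over the orbit of zero

Tr : (ℓ k : ℕ) → List (Tup ℓ (suc k))
Tr ℓ k = filter transitive? (C ℓ (suc k))

-- Index shift: t ℓ k counts the transitive tuples on k + 1 points.
h t : ℕ → ℕ → ℕ
h ℓ n = length (C ℓ n)
t ℓ k = length (Tr ℓ k)

-- Equal to the sum over i of binom(n, i) f(i, n - i); Pascal's rule is built in by placing one
-- point at a time.
sumSplit : ℕ → (ℕ → ℕ → ℕ) → ℕ
sumSplit zero    f = f 0 0
sumSplit (suc n) f = sumSplit n (f ∘ suc) + sumSplit n (λ i j → f i (suc j))

sum-bits : ∀ n f → sum (map (λ v → f (#t v) (#f v)) (bits n)) ≡ sumSplit n f
sum-bits zero    f = +-identityʳ _
sum-bits (suc n) f = begin
  sum (map g (map (true ∷_) (bits n) ++ map (false ∷_) (bits n)))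
    ≡⟨ cong sum (map-++ g (map (true ∷_) (bits n)) _) ⟩
  sum (map g (map (true ∷_) (bits n)) ++ map g (map (false ∷_) (bits n)))
    ≡⟨ sum-++ (map g (map (true ∷_) (bits n))) _ ⟩
  sum (map g (map (true ∷_) (bits n))) + sum (map g (map (false ∷_) (bits n)))
    ≡⟨ cong₂ _+_ (cong sum (sym (map-∘ (bits n)))) (cong sum (sym (map-∘ (bits n)))) ⟩
  sum (map (g ∘ (true ∷_)) (bits n)) + sum (map (g ∘ (false ∷_)) (bits n))
    ≡⟨ cong₂ _+_ (sum-bits n (f ∘ suc)) (sum-bits n λ i j → f i (suc j)) ⟩
  sumSplit n (f ∘ suc) + sumSplit n (λ i j → f i (suc j)) ∎
  where
  open ≡-Reasoning
  g : Vec Bool (suc n) → ℕ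
  g v = f (#t v) (#f v)

module _ (ℓ n : ℕ) where

  private
    glued : Vec Bool n → List (Tup ℓ (suc n))
    glued v = cartesianProductWith (glue (true ∷ v)) (Tr ℓ (#t v)) (C ℓ (#f v))

    ∈-Tr⁻ : ∀ {k} {σ : Tup ℓ (suc k)} → σ ∈ Tr ℓ k → Good σ × Transitive σ
    ∈-Tr⁻ {k} m = let m′ , tr = ∈-filter⁻ transitive? {xs = C ℓ (suc k)} m in ∈-C⁻ m′ , tr

    ∈-glued⁻ : ∀ v {π} → π ∈ glued v → Good π × IsOrbit (true ∷ v) π
    ∈-glued⁻ v m with ∈-cartesianProductWith⁻ (glue (true ∷ v)) (Tr ℓ (#t v)) (C ℓ (#f v)) m
    ... | σ , τ , mσ , mτ , refl = let g , tr = ∈-Tr⁻ mσ in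
      glue-good (true ∷ v) σ τ g (∈-C⁻ mτ) , glue-orbit v σ τ tr

    ∈-glued⁺ : ∀ v {π} (g : Good π) (o : IsOrbit (true ∷ v) π) → π ∈ glued v
    ∈-glued⁺ v {π} g o@(orbit _ c _) = subst (_∈ glued v) (glue-restrict w π g c)
      (∈-cartesianProductWith⁺ (glue w)
        (∈-filter⁺ transitive? (∈-C⁺ (restrict₁-good w π g c)) (restrict-transitive v π g o))
        (∈-C⁺ (restrict₂-good w π g c)))
      where w = true ∷ v

    split-C : ∀ {π} → π ∈ C ℓ (suc n) → π ∈ concatMap glued (bits n)
    split-C {π} m with orbit-exists π
    -- The orbit contains zero, so its bit vector cannot begin with `false`.
    ... | true ∷ v , o = ∈-concatMap⁺′ glued (∈-bits v) (∈-glued⁺ v (∈-C⁻ m) o)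

    unsplit-C : ∀ {π} → π ∈ concatMap glued (bits n) → π ∈ C ℓ (suc n)
    unsplit-C m = let v , _ , m′ = ∈-concatMap⁻′ glued {bits n} m in ∈-C⁺ (proj₁ (∈-glued⁻ v m′))

    Unique-glued : Unique (concatMap glued (bits n))
    Unique-glued = Unique-concatMap glued (Unique-bits n)
      (λ {v} _ → UP.cartesianProductWith⁺ (glue (true ∷ v)) (glue-injective (true ∷ v))
        (UP.filter⁺ transitive? (Unique-C ℓ _)) (Unique-C ℓ _))
      -- A glued tuple determines its bit vector, which is the orbit of zero; hence the blocks are
      -- disjoint.
      λ {v} {v′} _ _ p q → VP.∷-injectiveʳ (IsOrbit-unique (proj₂ (∈-glued⁻ v p)) (proj₂ (∈-glued⁻ v′ q)))

  h-recursion : h ℓ (suc n) ≡ sumSplit n (λ i j → t ℓ i * h ℓ j)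
  h-recursion = begin
    h ℓ (suc n)                          ≡⟨ Unique-⇔⇒length≡ (Unique-C ℓ (suc n)) Unique-glued split-C unsplit-C ⟩
    length (concatMap glued (bits n))    ≡⟨ length-concatMap glued (bits n) ⟩
    sum (map (length ∘ glued) (bits n))  ≡⟨ cong sum (map-cong (λ v → length-cartesianProductWith (glue (true ∷ v)) (Tr ℓ (#t v)) _) (bits n)) ⟩
    sum (map (λ v → t ℓ (#t v) * h ℓ (#f v)) (bits n)) ≡⟨ sum-bits n (λ i j → t ℓ i * h ℓ j) ⟩
    sumSplit n (λ i j → t ℓ i * h ℓ j)   ∎
    where open ≡-Reasoning

-- Counting commuting tuples through centralizers

G : ∀ {n} → ℕ → List (Map n) → ℕ
G ℓ cs = length (commuting ℓ cs)

cent : ∀ {n} → Map n → List (Map n) → List (Map n)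
cent c = filterᵇ (commuteᵇ c)

profile : ∀ {n} → List (Map n) → List ℕ
profile cs = map (λ c → length (cent c cs)) cs

-- Comparing lengths makes this a test on numbers; as `cent` is a filter, equal length forces
-- equality of the lists.
Abelian : ∀ {n} → List (Map n) → Set
Abelian cs = All (λ c → length (cent c cs) ≡ length cs) cs

abelian? : ∀ {n} (cs : List (Map n)) → Dec (Abelian cs)
abelian? cs = All.all? (λ c → length (cent c cs) ≟ length cs) cs

cent-all : ∀ {n} (c : Map n) {cs} → length (cent c cs) ≡ length cs → cent c cs ≡ cs
cent-all c = filter-complete (T? ∘ commuteᵇ c)

module _ {n} (ℓ : ℕ) {cs : List (Map n)} (u : Unique cs) where

  private
    tails : Map n → List (Tup (suc ℓ) n)
    tails c = map (c ∷_) (commuting ℓ (cent c cs))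

    ∈-cent⁺ : ∀ c {d} → d ∈ cs → Comm c d → d ∈ cent c cs
    ∈-cent⁺ c {d} m p = ∈-filter⁺ (T? ∘ commuteᵇ c) m (commuteᵇ⁺ {σ = c} {d} p)

    ∈-cent⁻ : ∀ c {d} → d ∈ cent c cs → d ∈ cs × Comm c d
    ∈-cent⁻ c {d} m = let d∈ , p = ∈-filter⁻ (T? ∘ commuteᵇ c) {xs = cs} m in d∈ , commuteᵇ⁻ {σ = c} {d} p

    fwd : ∀ {π} → π ∈ commuting (suc ℓ) cs → π ∈ concatMap tails cs
    fwd {c ∷ π} m = let v , q = ∈-commuting⁻ (c ∷ π) m in
      ∈-concatMap⁺′ tails (v zero) (∈-map⁺ (c ∷_)
        (∈-commuting⁺ π (λ i → ∈-cent⁺ c (v (suc i)) (q zero (suc i))) λ j k → q (suc j) (suc k)))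

    bwd : ∀ {π} → π ∈ concatMap tails cs → π ∈ commuting (suc ℓ) cs
    bwd m with ∈-concatMap⁻′ tails {cs} m
    ... | c , c∈ , m′ with ∈-map⁻ (c ∷_) m′
    ... | π , π∈ , refl with ∈-commuting⁻ π π∈
    ... | v , p = ∈-commuting⁺ (c ∷ π) (λ { zero → c∈ ; (suc i) → proj₁ (d i) }) q
      where
      d : ∀ i → lookup π i ∈ cs × Comm c (lookup π i)
      d i = ∈-cent⁻ c (v i)
      q : ∀ j k → Comm (lookup (c ∷ π) j) (lookup (c ∷ π) k)
      q zero    zero    y = refl
      q zero    (suc k) y = proj₂ (d k) y
      q (suc j) zero    y = sym (proj₂ (d j) y)
      q (suc j) (suc k) y = p j k y

  -- Once the first entry `c` is chosen, the others form a commuting tuple in its centralizer.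
  G-suc : G (suc ℓ) cs ≡ sum (map (λ c → G ℓ (cent c cs)) cs)
  G-suc = trans (Unique-⇔⇒length≡ (Unique-commuting (suc ℓ) u)
      (Unique-concatMap tails u
        (λ {c} _ → UP.map⁺ VP.∷-injectiveʳ (Unique-commuting ℓ (UP.filter⁺ (T? ∘ commuteᵇ c) u)))
        λ {c} {c′} _ _ p q → let _ , _ , e = ∈-map⁻ (c ∷_) p
                                 _ , _ , f = ∈-map⁻ (c′ ∷_) q
                             in VP.∷-injectiveˡ (trans (sym e) f))
      fwd bwd)
    (trans (length-concatMap tails cs)
      (cong sum (map-cong (λ c → length-map (c ∷_) (commuting ℓ (cent c cs))) cs)))

  G-profile : (e : ℕ → ℕ) → All (λ c → G ℓ (cent c cs) ≡ e (length (cent c cs))) cs →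
    G (suc ℓ) cs ≡ sum (map e (profile cs))
  G-profile e a = trans G-suc (cong sum (trans (go a) (map-∘ cs)))
    where
    go : ∀ {ds} → All (λ c → G ℓ (cent c cs) ≡ e (length (cent c cs))) ds →
      map (λ c → G ℓ (cent c cs)) ds ≡ map (λ c → e (length (cent c cs))) ds
    go []      = refl
    go (p ∷ a) = cong₂ _∷_ p (go a)

Unique-cent : ∀ {n} (c : Map n) {cs} → Unique cs → Unique (cent c cs)
Unique-cent c = UP.filter⁺ (T? ∘ commuteᵇ c)

G-abelian : ∀ {n} ℓ {cs : List (Map n)} → Unique cs → Abelian cs → G ℓ cs ≡ length cs ^ ℓ
G-abelian zero    u a = refl
G-abelian (suc ℓ) {cs} u ab = trans (G-suc ℓ u) (go ab)
  where
  go : ∀ {ds} → All (λ c → length (cent c cs) ≡ length cs) ds →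
    sum (map (λ c → G ℓ (cent c cs)) ds) ≡ length ds * length cs ^ ℓ
  go []                = refl
  go {c ∷ _} (p ∷ a) = cong₂ _+_ (trans (cong (G ℓ) (cent-all c p)) (G-abelian ℓ u ab)) (go a)

-- The shape of S₃ and of the dihedral group of order 8: central elements reproduce the count
-- itself, all others contribute powers.
Layered : ∀ {n} → List (Map n) → Set
Layered cs = All (λ c → length (cent c cs) ≡ length cs ⊎ Abelian (cent c cs)) cs

layered? : ∀ {n} (cs : List (Map n)) → Dec (Layered cs)
layered? cs = All.all? (λ c → (length (cent c cs) ≟ length cs) ⊎-dec abelian? (cent c cs)) cs

G-layered : ∀ {n} ℓ {cs : List (Map n)} → Unique cs → Layered cs →
  G (suc ℓ) cs ≡ sum (map (λ m → if m ≡ᵇ length cs then G ℓ cs else m ^ ℓ) (profile cs))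
G-layered ℓ {cs} u lay = G-profile ℓ u _ (All.map (λ {c} → step {c}) lay)
  where
  step : ∀ {c} → length (cent c cs) ≡ length cs ⊎ Abelian (cent c cs) →
    G ℓ (cent c cs) ≡ (if length (cent c cs) ≡ᵇ length cs then G ℓ cs else length (cent c cs) ^ ℓ)
  step {c} p with length (cent c cs) ≡ᵇ length cs in eq
  step {c} p        | true  = cong (G ℓ) (cent-all c (≡ᵇ⇒≡ _ _ (subst T (sym eq) _)))
  step {c} (inj₂ a) | false = G-abelian ℓ (Unique-cent c u) a
  step {c} (inj₁ e) | false = ⊥-elim (subst T eq (≡⇒≡ᵇ _ _ e))

open DecMem (≡-dec _≟_) using (_∈?_)

-- The centralizers of the double transpositions of S₄.
dihedralProfiles : List (List ℕ)
dihedralProfiles =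
  (8 ∷ 4 ∷ 4 ∷ 8 ∷ 4 ∷ 4 ∷ 4 ∷ 4 ∷ []) ∷
  (8 ∷ 4 ∷ 4 ∷ 4 ∷ 4 ∷ 8 ∷ 4 ∷ 4 ∷ []) ∷
  (8 ∷ 4 ∷ 4 ∷ 4 ∷ 4 ∷ 4 ∷ 4 ∷ 8 ∷ []) ∷ []

Dihedral : ∀ {n} → List (Map n) → Set
Dihedral cs = profile cs ∈ dihedralProfiles × length cs ≡ 8 × Layered cs

dihedral? : ∀ {n} (cs : List (Map n)) → Dec (Dihedral cs)
dihedral? cs = (profile cs ∈? dihedralProfiles) ×-dec (length cs ≟ 8) ×-dec layered? cs

-- Two elements are central and the six others have abelian centralizers of order 4, so g(ℓ+1) = 2
-- g(ℓ) + 6·4^ℓ with g(0) = 1, which 3·4^ℓ - 2·2^ℓ solves.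
G-dihedral : ∀ {n} ℓ {cs : List (Map n)} → Unique cs → Dihedral cs → G ℓ cs + 2 * 2 ^ ℓ ≡ 3 * 4 ^ ℓ
G-dihedral zero    u d = refl
G-dihedral (suc ℓ) {cs} u d@(p , l , lay) = begin
  G (suc ℓ) cs + 2 * (2 * 2 ^ ℓ)                        ≡⟨ cong (_+ _) (trans (G-layered ℓ u lay) (rec p l)) ⟩
  2 * G ℓ cs + 6 * 4 ^ ℓ + 2 * (2 * 2 ^ ℓ)              ≡⟨ regroup (G ℓ cs) (2 ^ ℓ) (4 ^ ℓ) ⟩
  2 * (G ℓ cs + 2 * 2 ^ ℓ) + 6 * 4 ^ ℓ                  ≡⟨ cong (λ g → 2 * g + 6 * 4 ^ ℓ) (G-dihedral ℓ u d) ⟩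
  2 * (3 * 4 ^ ℓ) + 6 * 4 ^ ℓ                           ≡⟨ collect (4 ^ ℓ) ⟩
  3 * (4 * 4 ^ ℓ)                                       ∎
  where
  open ≡-Reasoning
  regroup : ∀ g x y → 2 * g + 6 * y + 2 * (2 * x) ≡ 2 * (g + 2 * x) + 6 * y
  regroup = solve-∀
  collect : ∀ y → 2 * (3 * y) + 6 * y ≡ 3 * (4 * y)
  collect = solve-∀
  -- One regrouping for each order in which a profile lists the two central elements.
  s₁ : ∀ g f → g + (f + (f + (g + (f + (f + (f + (f + 0))))))) ≡ 2 * g + 6 * f
  s₁ = solve-∀
  s₂ : ∀ g f → g + (f + (f + (f + (f + (g + (f + (f + 0))))))) ≡ 2 * g + 6 * f
  s₂ = solve-∀
  s₃ : ∀ g f → g + (f + (f + (f + (f + (f + (f + (g + 0))))))) ≡ 2 * g + 6 * f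
  s₃ = solve-∀
  rec : ∀ {ps k} → ps ∈ dihedralProfiles → k ≡ 8 →
    sum (map (λ m → if m ≡ᵇ k then G ℓ cs else m ^ ℓ) ps) ≡ 2 * G ℓ cs + 6 * 4 ^ ℓ
  rec (here refl)                 refl = s₁ (G ℓ cs) (4 ^ ℓ)
  rec (there (here refl))         refl = s₂ (G ℓ cs) (4 ^ ℓ)
  rec (there (there (here refl))) refl = s₃ (G ℓ cs) (4 ^ ℓ)

-- Commuting tuples on at most four points

h₀ : ∀ ℓ → h ℓ 0 ≡ 1
h₀ ℓ = trans (G-abelian ℓ (Unique-Sym 0) (toWitness {a? = abelian? (Sym 0)} _)) (^-zeroˡ ℓ)

h₁ : ∀ ℓ → h ℓ 1 ≡ 1
h₁ ℓ = trans (G-abelian ℓ (Unique-Sym 1) (toWitness {a? = abelian? (Sym 1)} _)) (^-zeroˡ ℓ)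

h₂ : ∀ ℓ → h ℓ 2 ≡ 2 ^ ℓ
h₂ ℓ = G-abelian ℓ (Unique-Sym 2) (toWitness {a? = abelian? (Sym 2)} _)

-- The identity, the three transpositions and the two 3-cycles have centralizers of orders 6, 2 and
-- 3, so each step in ℓ adds 3·2^ℓ + 2·3^ℓ.
h₃ : ∀ ℓ → h ℓ 3 + 3 ≡ 3 ^ ℓ + 3 * 2 ^ ℓ
h₃ zero    = refl
h₃ (suc ℓ) = begin
  h (suc ℓ) 3 + 3                               ≡⟨ cong (_+ 3) (G-layered ℓ (Unique-Sym 3) (toWitness {a? = layered? (Sym 3)} _)) ⟩
  h ℓ 3 + (2 ^ ℓ + (2 ^ ℓ + (3 ^ ℓ + (3 ^ ℓ + (2 ^ ℓ + 0))))) + 3 ≡⟨ regroup (h ℓ 3) (2 ^ ℓ) (3 ^ ℓ) ⟩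
  (h ℓ 3 + 3) + 3 * 2 ^ ℓ + 2 * 3 ^ ℓ           ≡⟨ cong (λ g → g + 3 * 2 ^ ℓ + 2 * 3 ^ ℓ) (h₃ ℓ) ⟩
  (3 ^ ℓ + 3 * 2 ^ ℓ) + 3 * 2 ^ ℓ + 2 * 3 ^ ℓ   ≡⟨ collect (2 ^ ℓ) (3 ^ ℓ) ⟩
  3 * 3 ^ ℓ + 3 * (2 * 2 ^ ℓ)                   ∎
  where
  open ≡-Reasoning
  regroup : ∀ g x y → g + (x + (x + (y + (y + (x + 0))))) + 3 ≡ (g + 3) + 3 * x + 2 * y
  regroup = solve-∀
  collect : ∀ x y → (y + 3 * x) + 3 * x + 2 * y ≡ 3 * y + 3 * (2 * x)
  collect = solve-∀

small≢ : ∀ {m k} → m < k → (m ≡ᵇ k) ≡ false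
small≢ {m} {k} lt with m ≡ᵇ k in eq
... | false = refl
... | true  = ⊥-elim (<⇒≢ lt (≡ᵇ⇒≡ m k (subst T (sym eq) _)))

-- The classes of S₄: the identity; three double transpositions with dihedral centralizers; six
-- transpositions, six 4-cycles and eight 3-cycles with abelian centralizers of order 4, 4 and 3.
-- The bound `< 8` lets `pick` separate the cases by order alone.
SymmetricLike : ∀ {n} → List (Map n) → Set
SymmetricLike cs = length cs ≡ 24 × All (λ c → length (cent c cs) ≡ 24 ⊎ Dihedral (cent c cs)
  ⊎ Abelian (cent c cs) × length (cent c cs) < 8) cs

symmetricLike? : ∀ {n} (cs : List (Map n)) → Dec (SymmetricLike cs)
symmetricLike? cs = (length cs ≟ 24) ×-dec All.all? (λ c → (length (cent c cs) ≟ 24) ⊎-dec dihedral? (cent c cs)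
  ⊎-dec (abelian? (cent c cs) ×-dec (length (cent c cs) <? 8))) cs

pick : ℕ → ℕ → ℕ → ℕ → ℕ
pick ℓ g d m = if m ≡ᵇ 24 then g else if m ≡ᵇ 8 then d else m ^ ℓ

G-symmetricLike : ∀ {n} ℓ {cs : List (Map n)} → Unique cs → SymmetricLike cs →
  G (suc ℓ) cs ≡ sum (map (pick ℓ (G ℓ cs) (3 * 4 ^ ℓ ∸ 2 * 2 ^ ℓ)) (profile cs))
G-symmetricLike ℓ {cs} u (size , sym₄) = G-profile ℓ u _ (All.map (λ {c} → step c) sym₄)
  where
  d = 3 * 4 ^ ℓ ∸ 2 * 2 ^ ℓ
  value : ℕ → ℕ
  value = pick ℓ (G ℓ cs) d
  step : ∀ c → length (cent c cs) ≡ 24 ⊎ Dihedral (cent c cs) ⊎ Abelian (cent c cs) × length (cent c cs) < 8 →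
    G ℓ (cent c cs) ≡ value (length (cent c cs))
  step c (inj₁ e) = trans (cong (G ℓ) (cent-all c (trans e (sym size)))) (sym (cong value e))
  step c (inj₂ (inj₁ di@(_ , l , _))) = trans (trans (sym (m+n∸n≡m _ (2 * 2 ^ ℓ)))
    (cong (_∸ 2 * 2 ^ ℓ) (G-dihedral ℓ (Unique-cent c u) di))) (sym (cong value l))
  step c (inj₂ (inj₂ (a , lt))) = trans (G-abelian ℓ (Unique-cent c u) a)
    (sym (trans (cong (λ b → if b then G ℓ cs else if k ≡ᵇ 8 then d else k ^ ℓ) (small≢ (<-≤-trans lt (m≤m+n 8 16))))
      (cong (λ b → if b then d else k ^ ℓ) (small≢ lt))))
    where k = length (cent c cs)

h₄-suc : ∀ ℓ → h (suc ℓ) 4 ≡ h ℓ 4 + 3 * (3 * 4 ^ ℓ ∸ 2 * 2 ^ ℓ) + 12 * 4 ^ ℓ + 8 * 3 ^ ℓ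
h₄-suc ℓ = trans (G-symmetricLike ℓ (Unique-Sym 4) (toWitness {a? = symmetricLike? (Sym 4)} _))
  (sumS₄ (h ℓ 4) (3 * 4 ^ ℓ ∸ 2 * 2 ^ ℓ) (4 ^ ℓ) (3 ^ ℓ))
  where
  sumS₄ : ∀ g d f x →
    g + (f + (f + (x + (x + (f + (f + (d + (x + (f + (f + (x + (x + (f + (f + (x + (d + (f + (f + (x + (x + (f + (f + (d + 0)))))))))))))))))))))))
    ≡ g + 3 * d + 12 * f + 8 * x
  sumS₄ = solve-∀

h₄ : ∀ ℓ → h ℓ 4 + 6 * 2 ^ ℓ + 4 ≡ 7 * 4 ^ ℓ + 4 * 3 ^ ℓ
h₄ zero    = refl
h₄ (suc ℓ) = begin
  h (suc ℓ) 4 + 6 * (2 * 2 ^ ℓ) + 4                     ≡⟨ cong (λ g → g + 6 * (2 * 2 ^ ℓ) + 4) (h₄-suc ℓ) ⟩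
  h ℓ 4 + 3 * d + 12 * 4 ^ ℓ + 8 * 3 ^ ℓ + 6 * (2 * 2 ^ ℓ) + 4
    ≡⟨ regroup (h ℓ 4) d (4 ^ ℓ) (3 ^ ℓ) (2 ^ ℓ) ⟩
  (h ℓ 4 + 6 * 2 ^ ℓ + 4) + 3 * (d + 2 * 2 ^ ℓ) + 12 * 4 ^ ℓ + 8 * 3 ^ ℓ
    -- The truncated subtraction in `d` is exact because 2·2^ℓ ≤ 3·4^ℓ.
    ≡⟨ cong₂ (λ g k → g + 3 * k + 12 * 4 ^ ℓ + 8 * 3 ^ ℓ) (h₄ ℓ) (m∸n+n≡m (*-mono-≤ {2} {3} (s≤s (s≤s z≤n)) (^-monoˡ-≤ ℓ (s≤s (s≤s z≤n))))) ⟩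
  (7 * 4 ^ ℓ + 4 * 3 ^ ℓ) + 3 * (3 * 4 ^ ℓ) + 12 * 4 ^ ℓ + 8 * 3 ^ ℓ
    ≡⟨ collect (4 ^ ℓ) (3 ^ ℓ) ⟩
  7 * (4 * 4 ^ ℓ) + 4 * (3 * 3 ^ ℓ) ∎
  where
  open ≡-Reasoning
  d = 3 * 4 ^ ℓ ∸ 2 * 2 ^ ℓ
  regroup : ∀ g d f x y → g + 3 * d + 12 * f + 8 * x + 6 * (2 * y) + 4 ≡ (g + 6 * y + 4) + 3 * (d + 2 * y) + 12 * f + 8 * x
  regroup = solve-∀
  collect : ∀ f x → (7 * f + 4 * x) + 3 * (3 * f) + 12 * f + 8 * x ≡ 7 * (4 * f) + 4 * (3 * x)
  collect = solve-∀

-- An upper bound for the number of transitive tuples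

sublists : {A : Set} → List A → List (List A)
sublists []       = [] ∷ []
sublists (x ∷ xs) = map (x ∷_) (sublists xs) ++ sublists xs

filter∈sublists : {A : Set} {P : A → Set} (P? : Decidable P) (xs : List A) → filter P? xs ∈ sublists xs
filter∈sublists P? []       = here refl
filter∈sublists P? (x ∷ xs) with does (P? x)
... | true  = ∈-++⁺ˡ (∈-map⁺ (x ∷_) (filter∈sublists P? xs))
... | false = ∈-++⁺ʳ _ (filter∈sublists P? xs)

Unique-map-∈ : {A B : Set} (f : A → B) {xs : List A} →
  (∀ {x y} → x ∈ xs → y ∈ xs → f x ≡ f y → x ≡ y) → Unique xs → Unique (map f xs)
Unique-map-∈ f inj []       = []
Unique-map-∈ f inj (x∉ ∷ u) =
  All.tabulate (λ m e → let y , y∈ , f≡ = ∈-map⁻ f m in All.lookup x∉ y∈ (inj (here refl) (there y∈) (trans e f≡)))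
  ∷ Unique-map-∈ f (λ p q → inj (there p) (there q)) u

length-concatMap≤ : {A B : Set} (f : A → List B) {xs : List A} {b : ℕ} → (∀ {x} → x ∈ xs → length (f x) ≤ b) →
  length (concatMap f xs) ≤ length xs * b
length-concatMap≤ f {xs} {b} bd = subst (_≤ _) (sym (length-concatMap f xs)) (go bd)
  where
  go : ∀ {ys} → (∀ {x} → x ∈ ys → length (f x) ≤ b) → sum (map (length ∘ f) ys) ≤ length ys * b
  go {[]}     _  = z≤n
  go {y ∷ ys} bd = +-mono-≤ (bd (here refl)) (go (bd ∘ there))

-- The maps commuting with a transitive tuple are determined by the image of zero, since two of them agree
-- on a closed set.  So the tuple consists of members of a set of at most k + 1 maps.

maps : (n : ℕ) → List (Map n)
maps n = vecsOf n (allFin n)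

module _ {ℓ k} (π : Tup ℓ (suc k)) where

  private
    Centralizes : Map (suc k) → Set
    Centralizes g = ∀ j y → lookup g (act π j y) ≡ act π j (lookup g y)

    centralizes? : Decidable Centralizes
    centralizes? g = FP.all? λ j → FP.all? λ y → lookup g (act π j y) F.≟ act π j (lookup g y)

  centralizer : List (Map (suc k))
  centralizer = filter centralizes? (maps (suc k))

  ∈-centralizer : (∀ i j → Comm (lookup π i) (lookup π j)) → ∀ i → lookup π i ∈ centralizer
  ∈-centralizer c i = ∈-filter⁺ centralizes? (∈-vecsOf⁺ (lookup π i) λ _ → ∈-allFin _) (c i)

  length-centralizer : Transitive π → length centralizer ≤ suc k
  length-centralizer tr = begin
    length centralizer                          ≡⟨ length-map (λ g → lookup g zero) centralizer ⟨
    length (map (λ g → lookup g zero) centralizer) ≤⟨ Unique-⊆⇒length≤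
      (Unique-map-∈ _ determined (UP.filter⁺ centralizes? (Unique-vecsOf (suc k) (UP.allFin⁺ (suc k))))) (λ _ → ∈-allFin _) ⟩
    length (allFin (suc k))                     ≡⟨ length-tabulate {n = suc k} id ⟩
    suc k                                       ∎
    where
    open ≤-Reasoning
    agree? : (g g′ : Map (suc k)) → ∀ y → Dec (lookup g y ≡ lookup g′ y)
    agree? g g′ y = lookup g y F.≟ lookup g′ y
    determined : ∀ {g g′} → g ∈ centralizer → g′ ∈ centralizer → lookup g zero ≡ lookup g′ zero → g ≡ g′
    determined {g} {g′} m m′ e = vec-ext λ y → toBits⁻ (agree? g g′)
      (tr (toBits (agree? g g′)) (toBits⁺ (agree? g g′) {zero} e) closed y)
      where
      cg : Centralizes g
      cg = proj₂ (∈-filter⁻ centralizes? {xs = maps (suc k)} m)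
      cg′ : Centralizes g′
      cg′ = proj₂ (∈-filter⁻ centralizes? {xs = maps (suc k)} m′)
      closed : Closed (toBits (agree? g g′)) π
      closed j y t = toBits⁺ (agree? g g′)
        (trans (cg j y) (trans (cong (act π j) (toBits⁻ (agree? g g′) t)) (sym (cg′ j y))))

-- By the centralizer bound a transitive tuple is a vector over some sublist of at most k + 1 maps.
-- The number of sublists is a crude factor, but it does not depend on ℓ.
t≤ : ∀ ℓ k → t ℓ k ≤ length (sublists (maps (suc k))) * suc k ^ ℓ
t≤ ℓ k = begin
  t ℓ k                                  ≤⟨ Unique-⊆⇒length≤ (UP.filter⁺ transitive? (Unique-C ℓ (suc k))) covered ⟩
  length (concatMap (vecsOf ℓ) small)    ≤⟨ length-concatMap≤ (vecsOf ℓ) {small} (λ {Z} m →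
    ≤-trans (≤-reflexive (length-vecsOf ℓ Z)) (^-monoˡ-≤ ℓ (proj₂ (∈-filter⁻ size? {xs = sublists (maps (suc k))} m)))) ⟩
  length small * suc k ^ ℓ               ≤⟨ *-monoˡ-≤ (suc k ^ ℓ) (length-filter size? (sublists (maps (suc k)))) ⟩
  length (sublists (maps (suc k))) * suc k ^ ℓ ∎
  where
  open ≤-Reasoning
  open import Data.List.Properties using (length-filter)
  size? : (Z : List (Map (suc k))) → Dec (length Z ≤ suc k)
  size? Z = length Z ≤? suc k
  small = filter size? (sublists (maps (suc k)))
  covered : ∀ {π} → π ∈ Tr ℓ k → π ∈ concatMap (vecsOf ℓ) small
  covered {π} m = let π∈ , tr = ∈-filter⁻ transitive? {xs = C ℓ (suc k)} m in
    ∈-concatMap⁺′ (vecsOf ℓ) (∈-filter⁺ size? (filter∈sublists _ (maps (suc k))) (length-centralizer π tr))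
      (∈-vecsOf⁺ π (∈-centralizer π (com (∈-C⁻ π∈))))

-- The transitive tuples on at most four points

t₀ : ∀ ℓ → t ℓ 0 ≡ 1
t₀ ℓ = begin
  t ℓ 0         ≡⟨ *-identityʳ _ ⟨
  t ℓ 0 * 1     ≡⟨ cong (t ℓ 0 *_) (h₀ ℓ) ⟨
  t ℓ 0 * h ℓ 0 ≡⟨ h-recursion ℓ 0 ⟨
  h ℓ 1         ≡⟨ h₁ ℓ ⟩
  1             ∎
  where open ≡-Reasoning

t₁ : ∀ ℓ → t ℓ 1 + 1 ≡ 2 ^ ℓ
t₁ ℓ = begin
  t ℓ 1 + 1                             ≡⟨ e (t ℓ 1) ⟩
  t ℓ 1 * 1 + 1 * 1                     ≡⟨ cong₂ _+_ (cong (t ℓ 1 *_) (h₀ ℓ)) (cong₂ _*_ (t₀ ℓ) (h₁ ℓ)) ⟨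
  t ℓ 1 * h ℓ 0 + t ℓ 0 * h ℓ 1         ≡⟨ h-recursion ℓ 1 ⟨
  h ℓ 2                                 ≡⟨ h₂ ℓ ⟩
  2 ^ ℓ                                 ∎
  where
  open ≡-Reasoning
  e : ∀ t → t + 1 ≡ t * 1 + 1 * 1
  e = solve-∀

t₂ : ∀ ℓ → t ℓ 2 + 1 ≡ 3 ^ ℓ
t₂ ℓ = +-cancelʳ-≡ (3 * 2 ^ ℓ) _ _ (begin
  t ℓ 2 + 1 + 3 * 2 ^ ℓ                         ≡⟨ cong (λ x → t ℓ 2 + 1 + 3 * x) (t₁ ℓ) ⟨
  t ℓ 2 + 1 + 3 * (t ℓ 1 + 1)                   ≡⟨ e (t ℓ 2) (t ℓ 1) ⟩
  t ℓ 2 * 1 + t ℓ 1 * 1 + (t ℓ 1 * 1 + 1 * (t ℓ 1 + 1)) + 3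
    ≡⟨ cong (_+ 3) (cong₂ (λ a b → t ℓ 2 * a + t ℓ 1 * b + (t ℓ 1 * b + 1 * (t ℓ 1 + 1))) (h₀ ℓ) (h₁ ℓ)) ⟨
  t ℓ 2 * h ℓ 0 + t ℓ 1 * h ℓ 1 + (t ℓ 1 * h ℓ 1 + 1 * (t ℓ 1 + 1)) + 3
    ≡⟨ cong (λ x → t ℓ 2 * h ℓ 0 + t ℓ 1 * h ℓ 1 + (t ℓ 1 * h ℓ 1 + x) + 3) (cong₂ _*_ (t₀ ℓ) (trans (h₂ ℓ) (sym (t₁ ℓ)))) ⟨
  t ℓ 2 * h ℓ 0 + t ℓ 1 * h ℓ 1 + (t ℓ 1 * h ℓ 1 + t ℓ 0 * h ℓ 2) + 3 ≡⟨ cong (_+ 3) (h-recursion ℓ 2) ⟨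
  h ℓ 3 + 3                                     ≡⟨ h₃ ℓ ⟩
  3 ^ ℓ + 3 * 2 ^ ℓ                             ∎)
  where
  open ≡-Reasoning
  e : ∀ t t′ → t + 1 + 3 * (t′ + 1) ≡ t * 1 + t′ * 1 + (t′ * 1 + 1 * (t′ + 1)) + 3
  e = solve-∀

^-distribʳ-* : ∀ a b n → (a * b) ^ n ≡ a ^ n * b ^ n
^-distribʳ-* a b zero    = refl
^-distribʳ-* a b (suc n) = trans (cong (a * b *_) (^-distribʳ-* a b n)) ([m*n]*[o*p]≡[m*o]*[n*p] a b (a ^ n) (b ^ n))

t₃ : ∀ ℓ → t ℓ 3 + 6 * 2 ^ ℓ ≡ 4 * (2 ^ ℓ * 2 ^ ℓ) + 2
-- The recursion expresses h(4) through t(4) and smaller orbits of zero. The cancelled summand is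
-- the contribution of the latter plus the 4 of `h₄`, with a = X - 1 and b = Y - 1.
t₃ ℓ = +-cancelʳ-≡ (3 * (a * a) + 6 * a + 5 + 4 * b) _ _ (begin
  c + 6 * 2 ^ ℓ + (3 * (a * a) + 6 * a + 5 + 4 * b)  ≡⟨ cong (λ x → c + 6 * x + (3 * (a * a) + 6 * a + 5 + 4 * b)) (t₁ ℓ) ⟨
  c + 6 * (a + 1) + (3 * (a * a) + 6 * a + 5 + 4 * b) ≡⟨ e₁ a b c ⟩
  expand c b a 1 1 1 (a + 1) (b + 3 * a + 1) + 6 * (a + 1) + 4
    ≡⟨ cong (λ y → expand c b a 1 1 1 (a + 1) y + 6 * (a + 1) + 4) h₃′ ⟨
  expand c b a 1 1 1 (a + 1) (h ℓ 3) + 6 * (a + 1) + 4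
    ≡⟨ cong (λ y → expand c b a 1 1 1 y (h ℓ 3) + 6 * (a + 1) + 4) (trans (h₂ ℓ) (sym (t₁ ℓ))) ⟨
  expand c b a 1 1 1 (h ℓ 2) (h ℓ 3) + 6 * (a + 1) + 4
    ≡⟨ cong (λ y → expand c b a 1 1 y (h ℓ 2) (h ℓ 3) + 6 * (a + 1) + 4) (h₁ ℓ) ⟨
  expand c b a 1 1 (h ℓ 1) (h ℓ 2) (h ℓ 3) + 6 * (a + 1) + 4
    ≡⟨ cong₂ (λ x y → expand c b a x y (h ℓ 1) (h ℓ 2) (h ℓ 3) + 6 * (a + 1) + 4) (t₀ ℓ) (h₀ ℓ) ⟨
  expand c b a (t ℓ 0) (h ℓ 0) (h ℓ 1) (h ℓ 2) (h ℓ 3) + 6 * (a + 1) + 4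
    ≡⟨ cong (λ y → y + 6 * (a + 1) + 4) (h-recursion ℓ 3) ⟨
  h ℓ 4 + 6 * (a + 1) + 4                            ≡⟨ cong (λ x → h ℓ 4 + 6 * x + 4) (t₁ ℓ) ⟩
  h ℓ 4 + 6 * 2 ^ ℓ + 4                              ≡⟨ h₄ ℓ ⟩
  7 * 4 ^ ℓ + 4 * 3 ^ ℓ                              ≡⟨ cong₂ (λ x y → 7 * x + 4 * y) (^-distribʳ-* 2 2 ℓ) (sym (t₂ ℓ)) ⟩
  7 * (2 ^ ℓ * 2 ^ ℓ) + 4 * (b + 1)                  ≡⟨ cong (λ x → 7 * (x * x) + 4 * (b + 1)) (t₁ ℓ) ⟨
  7 * ((a + 1) * (a + 1)) + 4 * (b + 1)              ≡⟨ e₂ a b ⟩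
  4 * ((a + 1) * (a + 1)) + 2 + (3 * (a * a) + 6 * a + 5 + 4 * b)
    ≡⟨ cong (λ x → 4 * (x * x) + 2 + (3 * (a * a) + 6 * a + 5 + 4 * b)) (t₁ ℓ) ⟩
  4 * (2 ^ ℓ * 2 ^ ℓ) + 2 + (3 * (a * a) + 6 * a + 5 + 4 * b) ∎)
  where
  open ≡-Reasoning
  a = t ℓ 1
  b = t ℓ 2
  c = t ℓ 3
  expand : ℕ → ℕ → ℕ → ℕ → ℕ → ℕ → ℕ → ℕ → ℕ
  expand t₃ t₂ t₁ t₀ h₀ h₁ h₂ h₃ = t₃ * h₀ + t₂ * h₁ + (t₂ * h₁ + t₁ * h₂) + (t₂ * h₁ + t₁ * h₂ + (t₁ * h₂ + t₀ * h₃))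
  e₁ : ∀ a b c → c + 6 * (a + 1) + (3 * (a * a) + 6 * a + 5 + 4 * b) ≡
    c * 1 + b * 1 + (b * 1 + a * (a + 1)) + (b * 1 + a * (a + 1) + (a * (a + 1) + 1 * (b + 3 * a + 1))) + 6 * (a + 1) + 4
  e₁ = solve-∀
  e₂ : ∀ a b → 7 * ((a + 1) * (a + 1)) + 4 * (b + 1) ≡ 4 * ((a + 1) * (a + 1)) + 2 + (3 * (a * a) + 6 * a + 5 + 4 * b)
  e₂ = solve-∀
  e₃ : ∀ a b → b + 1 + 3 * (a + 1) ≡ b + 3 * a + 1 + 3
  e₃ = solve-∀
  h₃′ : h ℓ 3 ≡ b + 3 * a + 1
  h₃′ = +-cancelʳ-≡ 3 _ _ (trans (h₃ ℓ) (trans (cong₂ (λ x y → x + 3 * y) (sym (t₂ ℓ)) (sym (t₁ ℓ))) (e₃ a b)))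

-- Asymptotic comparison of sequences indexed by ℓ

Seq : Set
Seq = ℕ → ℕ

infix 4 _≼_ _≪_

_≼_ : Seq → Seq → Set
f ≼ g = ∃ λ K → ∀ ℓ → f ℓ ≤ K * g ℓ

_≪_ : Seq → Seq → Set
f ≪ g = ∀ K → Cofinitely (λ ℓ → K * f ℓ ≤ g ℓ)

infixl 6 _⊕_
infixl 7 _⊗_

_⊕_ _⊗_ : Seq → Seq → Seq
(f ⊕ g) ℓ = f ℓ + g ℓ
(f ⊗ g) ℓ = f ℓ * g ℓ

≤⇒≼ : ∀ {f g} → (∀ ℓ → f ℓ ≤ g ℓ) → f ≼ g
≤⇒≼ p = 1 , λ ℓ → ≤-trans (p ℓ) (≤-reflexive (sym (*-identityˡ _)))

≼-refl : ∀ {f} → f ≼ f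
≼-refl = ≤⇒≼ λ _ → ≤-refl

≼-trans : ∀ {f g k} → f ≼ g → g ≼ k → f ≼ k
≼-trans {k = k} (K , p) (L , q) = K * L , λ ℓ →
  ≤-trans (p ℓ) (≤-trans (*-monoʳ-≤ K (q ℓ)) (≤-reflexive (sym (*-assoc K L (k ℓ)))))

≼-+ : ∀ {f g k} → f ≼ k → g ≼ k → f ⊕ g ≼ k
≼-+ {k = k} (K , p) (L , q) = K + L , λ ℓ →
  ≤-trans (+-mono-≤ (p ℓ) (q ℓ)) (≤-reflexive (sym (*-distribʳ-+ (k ℓ) K L)))

≼-* : ∀ {f f′ g g′} → f ≼ g → f′ ≼ g′ → f ⊗ f′ ≼ g ⊗ g′
≼-* {g = g} {g′} (K , p) (L , q) = K * L , λ ℓ →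
  ≤-trans (*-mono-≤ (p ℓ) (q ℓ)) (≤-reflexive ([m*n]*[o*p]≡[m*o]*[n*p] K (g ℓ) L (g′ ℓ)))

-- Bernoulli's inequality in the form (1 + 1/a)^ℓ ≥ 1 + ℓ/a.
bernoulli : ∀ a ℓ → a ^ ℓ * (a + ℓ) ≤ a * suc a ^ ℓ
bernoulli a zero    = ≤-reflexive (e a)
  where e : ∀ a → 1 * (a + 0) ≡ a * 1
        e = solve-∀
bernoulli a (suc ℓ) = begin
  a * x * (a + suc ℓ)         ≡⟨ e₁ a x ℓ ⟩
  a * (x * (a + ℓ)) + a * x   ≤⟨ +-mono-≤ (*-monoʳ-≤ a (bernoulli a ℓ)) (*-monoʳ-≤ a (^-monoˡ-≤ ℓ (n≤1+n a))) ⟩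
  a * (a * y) + a * y         ≡⟨ e₂ a y ⟩
  a * (suc a * y)             ∎
  where
  open ≤-Reasoning
  x = a ^ ℓ
  y = suc a ^ ℓ
  e₁ : ∀ a x ℓ → a * x * (a + suc ℓ) ≡ a * (x * (a + ℓ)) + a * x
  e₁ = solve-∀
  e₂ : ∀ a y → a * (a * y) + a * y ≡ a * (suc a * y)
  e₂ = solve-∀

^-≪ : ∀ {a b} → a < b → (a ^_) ≪ (b ^_)
^-≪ {zero}  {b} _  K = 1 , λ { (suc ℓ) _ → ≤-trans (≤-reflexive (*-zeroʳ K)) z≤n }
-- By Bernoulli the ratio of the powers is at least 1 + ℓ/(a+1), which exceeds K once ℓ ≥ K (a+1).
^-≪ {suc a} {b} lt K = K * suc a , λ ℓ le → *-cancelˡ-≤ (suc a) (begin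
  suc a * (K * suc a ^ ℓ)      ≡⟨ e (suc a) K (suc a ^ ℓ) ⟩
  suc a ^ ℓ * (K * suc a)      ≤⟨ *-monoʳ-≤ (suc a ^ ℓ) (≤-trans le (m≤n+m ℓ (suc a))) ⟩
  suc a ^ ℓ * (suc a + ℓ)      ≤⟨ bernoulli (suc a) ℓ ⟩
  suc a * (2 + a) ^ ℓ          ≤⟨ *-monoʳ-≤ (suc a) (^-monoˡ-≤ ℓ lt) ⟩
  suc a * b ^ ℓ                ∎)
  where
  open ≤-Reasoning
  e : ∀ a k x → a * (k * x) ≡ x * (k * a)
  e = solve-∀

-- A natural-number stand-in for 3 ^ (ℓ / 3).
z : Seq
z 0 = 1
z 1 = 2
z 2 = 3
z (suc (suc (suc ℓ))) = 3 * z ℓ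

private
  [3m]³ : ∀ m → (3 * m) ^ 3 ≡ 27 * m ^ 3
  [3m]³ = λ m → e m
    where e : ∀ m → (3 * m) * ((3 * m) * ((3 * m) * 1)) ≡ 27 * (m * (m * (m * 1)))
          e = solve-∀

-- The starting values 1, 2, 3 have cubes 1, 8, 27, each at least 3^ℓ and, for `z³≤`, at most 3·3^ℓ;
-- three steps in ℓ multiply everything by 27.
3^≤z³ : ∀ ℓ → 3 ^ ℓ ≤ z ℓ ^ 3
3^≤z³ 0 = s≤s z≤n
3^≤z³ 1 = s≤s (s≤s (s≤s z≤n))
3^≤z³ 2 = m≤m+n 9 18
3^≤z³ (suc (suc (suc ℓ))) = begin
  3 * (3 * (3 * 3 ^ ℓ)) ≡⟨ e (3 ^ ℓ) ⟩
  27 * 3 ^ ℓ            ≤⟨ *-monoʳ-≤ 27 (3^≤z³ ℓ) ⟩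
  27 * z ℓ ^ 3          ≡⟨ [3m]³ (z ℓ) ⟨
  (3 * z ℓ) ^ 3         ∎
  where open ≤-Reasoning
        e : ∀ x → 3 * (3 * (3 * x)) ≡ 27 * x
        e = solve-∀

z³≤ : ∀ ℓ → z ℓ ^ 3 ≤ 3 * 3 ^ ℓ
z³≤ 0 = s≤s z≤n
z³≤ 1 = m≤m+n 8 1
z³≤ 2 = ≤-refl
z³≤ (suc (suc (suc ℓ))) = begin
  (3 * z ℓ) ^ 3         ≡⟨ [3m]³ (z ℓ) ⟩
  27 * z ℓ ^ 3          ≤⟨ *-monoʳ-≤ 27 (z³≤ ℓ) ⟩
  27 * (3 * 3 ^ ℓ)      ≡⟨ e (3 ^ ℓ) ⟩
  3 * (3 * (3 * (3 * 3 ^ ℓ))) ∎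
  where open ≤-Reasoning
        e : ∀ x → 27 * (3 * x) ≡ 3 * (3 * (3 * (3 * x)))
        e = solve-∀

z>0 : ∀ ℓ → 0 < z ℓ
z>0 0 = s≤s z≤n
z>0 1 = s≤s z≤n
z>0 2 = s≤s z≤n
z>0 (suc (suc (suc ℓ))) = *-mono-< {0} {3} (s≤s z≤n) (z>0 ℓ)

-- Comparing cubes turns comparisons of these sequences into inequalities between numerals.
scale : ℕ → ℕ → Seq
scale B i ℓ = B ^ ℓ * z ℓ ^ i

^-swap : ∀ m n o → (m ^ n) ^ o ≡ (m ^ o) ^ n
^-swap m n o = trans (^-*-assoc m n o) (trans (cong (m ^_) (*-comm n o)) (sym (^-*-assoc m o n)))

cube≤ : ∀ B i ℓ → scale B i ℓ ^ 3 ≤ 3 ^ i * (B ^ 3 * 3 ^ i) ^ ℓ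
cube≤ B i ℓ = begin
  (B ^ ℓ * z ℓ ^ i) ^ 3             ≡⟨ ^-distribʳ-* (B ^ ℓ) (z ℓ ^ i) 3 ⟩
  (B ^ ℓ) ^ 3 * (z ℓ ^ i) ^ 3       ≡⟨ cong₂ _*_ (^-swap B ℓ 3) (^-swap (z ℓ) i 3) ⟩
  (B ^ 3) ^ ℓ * (z ℓ ^ 3) ^ i       ≤⟨ *-monoʳ-≤ ((B ^ 3) ^ ℓ) (^-monoˡ-≤ i (z³≤ ℓ)) ⟩
  (B ^ 3) ^ ℓ * (3 * 3 ^ ℓ) ^ i     ≡⟨ cong ((B ^ 3) ^ ℓ *_) (trans (^-distribʳ-* 3 (3 ^ ℓ) i) (cong (3 ^ i *_) (^-swap 3 ℓ i))) ⟩
  (B ^ 3) ^ ℓ * (3 ^ i * (3 ^ i) ^ ℓ) ≡⟨ e ((B ^ 3) ^ ℓ) (3 ^ i) ((3 ^ i) ^ ℓ) ⟩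
  3 ^ i * ((B ^ 3) ^ ℓ * (3 ^ i) ^ ℓ) ≡⟨ cong (3 ^ i *_) (^-distribʳ-* (B ^ 3) (3 ^ i) ℓ) ⟨
  3 ^ i * (B ^ 3 * 3 ^ i) ^ ℓ       ∎
  where
  open ≤-Reasoning
  e : ∀ x y w → x * (y * w) ≡ y * (x * w)
  e = solve-∀

cube≥ : ∀ D j ℓ → (D ^ 3 * 3 ^ j) ^ ℓ ≤ scale D j ℓ ^ 3
cube≥ D j ℓ = begin
  (D ^ 3 * 3 ^ j) ^ ℓ           ≡⟨ ^-distribʳ-* (D ^ 3) (3 ^ j) ℓ ⟩
  (D ^ 3) ^ ℓ * (3 ^ j) ^ ℓ     ≡⟨ cong ((D ^ 3) ^ ℓ *_) (^-swap 3 j ℓ) ⟩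
  (D ^ 3) ^ ℓ * (3 ^ ℓ) ^ j     ≤⟨ *-monoʳ-≤ ((D ^ 3) ^ ℓ) (^-monoˡ-≤ j (3^≤z³ ℓ)) ⟩
  (D ^ 3) ^ ℓ * (z ℓ ^ 3) ^ j   ≡⟨ cong₂ _*_ (^-swap D 3 ℓ) (^-swap (z ℓ) 3 j) ⟩
  (D ^ ℓ) ^ 3 * (z ℓ ^ j) ^ 3   ≡⟨ ^-distribʳ-* (D ^ ℓ) (z ℓ ^ j) 3 ⟨
  (D ^ ℓ * z ℓ ^ j) ^ 3         ∎
  where open ≤-Reasoning

cube-cancel-≤ : ∀ {m n} → m ^ 3 ≤ n ^ 3 → m ≤ n
cube-cancel-≤ {m} {n} le = ≮⇒≥ λ lt → <⇒≱ (^-monoˡ-< 3 lt) le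

m≤m³ : ∀ m → m ≤ m ^ 3
m≤m³ zero    = z≤n
m≤m³ (suc m) = m≤m*n (suc m) (suc m * (suc m * 1)) {{m*n≢0 (suc m) (suc m * 1) {{_}} {{m*n≢0 (suc m) 1}}}}

scale-≼ : ∀ B i D j → B ^ 3 * 3 ^ i ≤ D ^ 3 * 3 ^ j → scale B i ≼ scale D j
-- The constant 3^i pays for the rounding of `z` in `z³≤`.
scale-≼ B i D j le = 3 ^ i , λ ℓ → cube-cancel-≤ (begin
  scale B i ℓ ^ 3                  ≤⟨ cube≤ B i ℓ ⟩
  3 ^ i * (B ^ 3 * 3 ^ i) ^ ℓ      ≤⟨ *-mono-≤ (m≤m³ (3 ^ i)) (≤-trans (^-monoˡ-≤ ℓ le) (cube≥ D j ℓ)) ⟩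
  (3 ^ i) ^ 3 * scale D j ℓ ^ 3    ≡⟨ ^-distribʳ-* (3 ^ i) (scale D j ℓ) 3 ⟨
  (3 ^ i * scale D j ℓ) ^ 3        ∎)
  where open ≤-Reasoning

scale-≪ : ∀ B i D j → B ^ 3 * 3 ^ i < D ^ 3 * 3 ^ j → scale B i ≪ scale D j
scale-≪ B i D j lt K with ^-≪ lt (K ^ 3 * 3 ^ i)
... | L , p = L , λ ℓ le → cube-cancel-≤ (begin
  (K * scale B i ℓ) ^ 3                  ≡⟨ ^-distribʳ-* K (scale B i ℓ) 3 ⟩
  K ^ 3 * scale B i ℓ ^ 3                ≤⟨ *-monoʳ-≤ (K ^ 3) (cube≤ B i ℓ) ⟩
  K ^ 3 * (3 ^ i * (B ^ 3 * 3 ^ i) ^ ℓ)  ≡⟨ *-assoc (K ^ 3) (3 ^ i) _ ⟨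
  K ^ 3 * 3 ^ i * (B ^ 3 * 3 ^ i) ^ ℓ    ≤⟨ p ℓ le ⟩
  (D ^ 3 * 3 ^ j) ^ ℓ                    ≤⟨ cube≥ D j ℓ ⟩
  scale D j ℓ ^ 3                        ∎)
  where open ≤-Reasoning

-- Sequences of weight n, up to an error of relative order 5^ℓ / z^5

-- Multiplying by z^5 keeps the error term 5^ℓ z^(n-5) integral when n < 5.

infix 4 _≲[_]_ _≈[_]_

z^ : ℕ → Seq
z^ n ℓ = z ℓ ^ n

_≲[_]_ : Seq → ℕ → Seq → Set
f ≲[ n ] g = ∃ λ K → ∀ ℓ → f ℓ * z^ 5 ℓ ≤ g ℓ * z^ 5 ℓ + K * scale 5 n ℓ

-- The bounds by z^n belong to the relation because in a product each error is multiplied by the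
-- other factor.
record _≈[_]_ (f : Seq) (n : ℕ) (g : Seq) : Set where
  constructor approx
  field
    lower : f ≲[ n ] g
    upper : g ≲[ n ] f
    boundˡ : f ≼ z^ n
    boundʳ : g ≼ z^ n

open _≈[_]_ public

scale-* : ∀ m n ℓ → scale 5 m ℓ * z^ n ℓ ≡ scale 5 (m + n) ℓ
scale-* m n ℓ = trans (*-assoc (5 ^ ℓ) (z ℓ ^ m) (z ℓ ^ n)) (cong (5 ^ ℓ *_) (sym (^-distribˡ-+-* (z ℓ) m n)))

z^-+ : ∀ m n → z^ m ⊗ z^ n ≼ z^ (m + n)
z^-+ m n = ≤⇒≼ λ ℓ → ≤-reflexive (sym (^-distribˡ-+-* (z ℓ) m n))

≲-refl : ∀ {f n} → f ≲[ n ] f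
≲-refl = 0 , λ ℓ → m≤m+n _ _

≲-trans : ∀ {f g k n} → f ≲[ n ] g → g ≲[ n ] k → f ≲[ n ] k
≲-trans {f} {g} {k} {n} (K , p) (L , q) = L + K , λ ℓ → begin
  f ℓ * z^ 5 ℓ                                      ≤⟨ p ℓ ⟩
  g ℓ * z^ 5 ℓ + K * scale 5 n ℓ                    ≤⟨ +-monoˡ-≤ _ (q ℓ) ⟩
  k ℓ * z^ 5 ℓ + L * scale 5 n ℓ + K * scale 5 n ℓ  ≡⟨ e (k ℓ * z^ 5 ℓ) (scale 5 n ℓ) L K ⟩
  k ℓ * z^ 5 ℓ + (L + K) * scale 5 n ℓ              ∎
  where
  open ≤-Reasoning
  e : ∀ x s l k → x + l * s + k * s ≡ x + (l + k) * s
  e = solve-∀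

≲-+ : ∀ {f g f′ g′ n} → f ≲[ n ] g → f′ ≲[ n ] g′ → f ⊕ f′ ≲[ n ] g ⊕ g′
≲-+ {f} {g} {f′} {g′} {n} (K , p) (L , q) = K + L , λ ℓ → begin
  (f ℓ + f′ ℓ) * z^ 5 ℓ               ≡⟨ *-distribʳ-+ (z^ 5 ℓ) (f ℓ) (f′ ℓ) ⟩
  f ℓ * z^ 5 ℓ + f′ ℓ * z^ 5 ℓ        ≤⟨ +-mono-≤ (p ℓ) (q ℓ) ⟩
  (g ℓ * z^ 5 ℓ + K * scale 5 n ℓ) + (g′ ℓ * z^ 5 ℓ + L * scale 5 n ℓ) ≡⟨ e (g ℓ) (g′ ℓ) (z^ 5 ℓ) (scale 5 n ℓ) K L ⟩
  (g ℓ + g′ ℓ) * z^ 5 ℓ + (K + L) * scale 5 n ℓ ∎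
  where
  open ≤-Reasoning
  e : ∀ x y u s k l → (x * u + k * s) + (y * u + l * s) ≡ (x + y) * u + (k + l) * s
  e = solve-∀

-- Replaces `f` first and `f′` second, so the two errors are multiplied by `f′` and by `g`.
≲-* : ∀ {f g f′ g′ m n} → f ≲[ m ] g → f′ ≲[ n ] g′ → f′ ≼ z^ n → g ≼ z^ m → f ⊗ f′ ≲[ m + n ] g ⊗ g′
≲-* {f} {g} {f′} {g′} {m} {n} (K , p) (L , q) (B , b) (A , a) = A * L + K * B , λ ℓ → begin
  f ℓ * f′ ℓ * z^ 5 ℓ                                   ≡⟨ e₁ (f ℓ) (f′ ℓ) (z^ 5 ℓ) ⟩
  (f ℓ * z^ 5 ℓ) * f′ ℓ                                 ≤⟨ *-monoˡ-≤ (f′ ℓ) (p ℓ) ⟩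
  (g ℓ * z^ 5 ℓ + K * scale 5 m ℓ) * f′ ℓ               ≡⟨ e₂ (g ℓ) (f′ ℓ) (z^ 5 ℓ) K (scale 5 m ℓ) ⟩
  g ℓ * (f′ ℓ * z^ 5 ℓ) + K * (scale 5 m ℓ * f′ ℓ)      ≤⟨ +-mono-≤ (*-monoʳ-≤ (g ℓ) (q ℓ)) (*-monoʳ-≤ K (*-monoʳ-≤ (scale 5 m ℓ) (b ℓ))) ⟩
  g ℓ * (g′ ℓ * z^ 5 ℓ + L * scale 5 n ℓ) + K * (scale 5 m ℓ * (B * z^ n ℓ))
    ≡⟨ e₃ (g ℓ) (g′ ℓ) (z^ 5 ℓ) (scale 5 n ℓ) (scale 5 m ℓ) (z^ n ℓ) K L B ⟩
  g ℓ * g′ ℓ * z^ 5 ℓ + L * (g ℓ * scale 5 n ℓ) + K * B * (scale 5 m ℓ * z^ n ℓ)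
    ≤⟨ +-mono-≤ (+-monoʳ-≤ (g ℓ * g′ ℓ * z^ 5 ℓ) (*-monoʳ-≤ L (*-monoˡ-≤ (scale 5 n ℓ) (a ℓ)))) (≤-reflexive (cong (K * B *_) (scale-* m n ℓ))) ⟩
  g ℓ * g′ ℓ * z^ 5 ℓ + L * (A * z^ m ℓ * scale 5 n ℓ) + K * B * scale 5 (m + n) ℓ
    ≡⟨ cong (λ s → g ℓ * g′ ℓ * z^ 5 ℓ + s + K * B * scale 5 (m + n) ℓ) (trans (e₄ L A (z^ m ℓ) (scale 5 n ℓ))
         (cong (A * L *_) (trans (scale-* n m ℓ) (cong (λ k → scale 5 k ℓ) (+-comm n m))))) ⟩
  g ℓ * g′ ℓ * z^ 5 ℓ + A * L * scale 5 (m + n) ℓ + K * B * scale 5 (m + n) ℓ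
    ≡⟨ e₅ (g ℓ * g′ ℓ * z^ 5 ℓ) (scale 5 (m + n) ℓ) (A * L) (K * B) ⟩
  g ℓ * g′ ℓ * z^ 5 ℓ + (A * L + K * B) * scale 5 (m + n) ℓ ∎
  where
  open ≤-Reasoning
  e₁ : ∀ f f′ u → f * f′ * u ≡ (f * u) * f′
  e₁ = solve-∀
  e₂ : ∀ g f′ u k s → (g * u + k * s) * f′ ≡ g * (f′ * u) + k * (s * f′)
  e₂ = solve-∀
  e₃ : ∀ g g′ u s t w k l b → g * (g′ * u + l * s) + k * (t * (b * w)) ≡ g * g′ * u + l * (g * s) + k * b * (t * w)
  e₃ = solve-∀
  e₄ : ∀ l a w s → l * (a * w * s) ≡ a * l * (s * w)
  e₄ = solve-∀
  e₅ : ∀ x s l k → x + l * s + k * s ≡ x + (l + k) * s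
  e₅ = solve-∀

≈-refl : ∀ {f n} → f ≼ z^ n → f ≈[ n ] f
≈-refl {f} {n} b = approx (≲-refl {f} {n}) (≲-refl {f} {n}) b b

≈-sym : ∀ {f g n} → f ≈[ n ] g → g ≈[ n ] f
≈-sym (approx p q a b) = approx q p b a

≈-trans : ∀ {f g k n} → f ≈[ n ] g → g ≈[ n ] k → f ≈[ n ] k
≈-trans {f} {g} {k} {n} (approx p q a _) (approx p′ q′ _ b) =
  approx (≲-trans {f} {g} {k} {n} p p′) (≲-trans {k} {g} {f} {n} q′ q) a b

≈-+ : ∀ {f g f′ g′ n} → f ≈[ n ] g → f′ ≈[ n ] g′ → f ⊕ f′ ≈[ n ] g ⊕ g′
≈-+ {f} {g} {f′} {g′} {n} (approx p q a b) (approx p′ q′ a′ b′) =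
  approx (≲-+ {f} {g} {f′} {g′} {n} p p′) (≲-+ {g} {f} {g′} {f′} {n} q q′) (≼-+ a a′) (≼-+ b b′)

≈-* : ∀ {f g f′ g′ m n} → f ≈[ m ] g → f′ ≈[ n ] g′ → f ⊗ f′ ≈[ m + n ] g ⊗ g′
≈-* {f} {g} {f′} {g′} {m} {n} (approx p q a b) (approx p′ q′ a′ b′) =
  approx (≲-* {f} {g} {f′} {g′} {m} {n} p p′ a′ b) (≲-* {g} {f} {g′} {f′} {m} {n} q q′ b′ a)
    (≼-trans (≼-* a a′) (z^-+ m n)) (≼-trans (≼-* b b′) (z^-+ m n))

≈-cong : ∀ {f g f′ g′ n} → (∀ ℓ → f ℓ ≡ f′ ℓ) → (∀ ℓ → g ℓ ≡ g′ ℓ) → f ≈[ n ] g → f′ ≈[ n ] g′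
≈-cong {f} {g} {f′} {g′} {n} e e′ (approx (K , p) (L , q) (A , a) (B , b)) = approx
  (K , λ ℓ → subst₂ (λ x y → x * z^ 5 ℓ ≤ y * z^ 5 ℓ + K * scale 5 n ℓ) (e ℓ) (e′ ℓ) (p ℓ))
  (L , λ ℓ → subst₂ (λ x y → x * z^ 5 ℓ ≤ y * z^ 5 ℓ + L * scale 5 n ℓ) (e′ ℓ) (e ℓ) (q ℓ))
  (A , λ ℓ → subst (_≤ A * z^ n ℓ) (e ℓ) (a ℓ))
  (B , λ ℓ → subst (_≤ B * z^ n ℓ) (e′ ℓ) (b ℓ))

constant : ℕ → Seq
constant c _ = c

≈-constant : ∀ c → constant c ≈[ 0 ] constant c
≈-constant c = ≈-refl (c , λ _ → ≤-reflexive (sym (*-identityʳ c)))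

≈-scalar : ∀ c {f g n} → f ≈[ n ] g → constant c ⊗ f ≈[ n ] constant c ⊗ g
≈-scalar c = ≈-* (≈-constant c)

≈-sumSplit : ∀ n {m} {f g : ℕ → ℕ → Seq} → (∀ i j → i + j ≡ n → f i j ≈[ m ] g i j) →
  (λ ℓ → sumSplit n (λ i j → f i j ℓ)) ≈[ m ] (λ ℓ → sumSplit n (λ i j → g i j ℓ))
≈-sumSplit zero    p = p 0 0 refl
≈-sumSplit (suc n) p = ≈-+ (≈-sumSplit n λ i j e → p (suc i) j (cong suc e))
  (≈-sumSplit n λ i j e → p i (suc j) (trans (+-suc i j) (cong suc e)))

-- Transitive tuples

X Y : Seq
X = 2 ^_
Y = 3 ^_

pow≼z^ : ∀ B n → B ^ 3 ≤ 3 ^ n → (B ^_) ≼ z^ n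
pow≼z^ B n le = ≼-trans (≤⇒≼ λ ℓ → ≤-reflexive (sym (*-identityʳ (B ^ ℓ))))
  (≼-trans (scale-≼ B 0 1 n (≤-trans (≤-reflexive (*-identityʳ (B ^ 3))) (≤-trans le (≤-reflexive (sym (+-identityʳ _))))))
    (≤⇒≼ λ ℓ → ≤-reflexive (trans (cong (_* z ℓ ^ n) (^-zeroˡ ℓ)) (*-identityˡ _))))

≈0 : ∀ {f n} → f ⊗ z^ 5 ≼ scale 5 n → f ≼ z^ n → f ≈[ n ] constant 0
≈0 {n = n} (K , p) b = approx (K , p) (0 , λ ℓ → z≤n) b (0 , λ ℓ → z≤n)

-- The first numerical hypothesis is B/3^(n/3) ≤ 5/3^(5/3), cubed: at weight n the power B^ℓ falls
-- under the error.
≼-pow≈0 : ∀ {f} B n → f ≼ (B ^_) → B ^ 3 * 3 ^ 5 ≤ 5 ^ 3 * 3 ^ n → B ^ 3 ≤ 3 ^ n → f ≈[ n ] constant 0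
≼-pow≈0 B n p le le′ = ≈0 (≼-trans (≼-* p ≼-refl) (scale-≼ B 5 5 n le)) (≼-trans p (pow≼z^ B n le′))

-- The visible part of `t`, with the same index shift. A fixed point leaves no term: at weight 1 the
-- constant 1 has the rate 3^(-1/3) = 0.693..., below that of the error.
τ : ℕ → Seq
τ 1 = X
τ 2 = Y
τ 3 = constant 4 ⊗ (X ⊗ X)
τ _ = constant 0

X≈X : X ≈[ 2 ] X
X≈X = ≈-refl (pow≼z^ 2 2 (m≤m+n 8 1))

Y≈Y : Y ≈[ 3 ] Y
Y≈Y = ≈-refl (pow≼z^ 3 3 ≤-refl)

bounded≈0 : ∀ {f c n} → 1 ≤ n → (∀ ℓ → f ℓ ≤ c) → f ≈[ n ] constant 0
bounded≈0 {c = c} {suc n} _ b = ≼-pow≈0 1 (suc n)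
  (c , λ ℓ → ≤-trans (b ℓ) (≤-reflexive (sym (trans (cong (c *_) (^-zeroˡ ℓ)) (*-identityʳ c)))))
  (≤-trans (m≤m+n (1 * 3 ^ 5) 132) (*-monoʳ-≤ 125 (^-monoʳ-≤ 3 {1} {suc n} (s≤s z≤n))))
  (^-monoʳ-≤ 3 {0} {suc n} z≤n)

1≈0 : ∀ n → 1 ≤ n → constant 1 ≈[ n ] constant 0
1≈0 n 1≤n = bounded≈0 1≤n λ _ → ≤-refl

≈-absorb : ∀ {f g k n} → f ≈[ n ] g → k ≈[ n ] constant 0 → f ⊕ k ≈[ n ] g
≈-absorb {g = g} p q = ≈-cong (λ _ → refl) (λ ℓ → +-identityʳ (g ℓ)) (≈-+ p q)

≈-unabsorb : ∀ {f g k n} → f ⊕ k ≈[ n ] g → k ≈[ n ] constant 0 → f ≈[ n ] g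
≈-unabsorb {f} {g} {k} {n} p q = ≈-trans (≈-sym (≈-absorb (≈-refl (≼-trans (≤⇒≼ λ ℓ → m≤m+n (f ℓ) (k ℓ)) (boundˡ p))) q)) p

-- The quotient k/3^(k/3) decreases from k = 5 on. The step is (6 + k)³ ≤ 3 (5 + k)³, whose
-- difference is the polynomial that is added.
5+k-cubed : ∀ k → (5 + k) ^ 3 * 3 ^ 5 ≤ 5 ^ 3 * 3 ^ (5 + k)
5+k-cubed zero    = ≤-refl
5+k-cubed (suc k) = begin
  (6 + k) ^ 3 * 243                           ≤⟨ *-monoˡ-≤ 243 (≤-trans (m≤m+n ((6 + k) ^ 3) (2 * (k * (k * k)) + 27 * (k * k) + 117 * k + 159)) (≤-reflexive (e k))) ⟩
  3 * (5 + k) ^ 3 * 243                       ≡⟨ *-assoc 3 ((5 + k) ^ 3) 243 ⟩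
  3 * ((5 + k) ^ 3 * 243)                     ≤⟨ *-monoʳ-≤ 3 (5+k-cubed k) ⟩
  3 * (125 * 3 ^ (5 + k))                     ≡⟨ e′ (3 ^ (5 + k)) ⟩
  125 * (3 * 3 ^ (5 + k))                     ∎
  where
  open ≤-Reasoning
  e : ∀ k → (6 + k) * ((6 + k) * ((6 + k) * 1)) + (2 * (k * (k * k)) + 27 * (k * k) + 117 * k + 159) ≡ 3 * ((5 + k) * ((5 + k) * ((5 + k) * 1)))
  e = solve-∀
  e′ : ∀ x → 3 * (125 * x) ≡ 125 * (3 * x)
  e′ = solve-∀

t≈τ : ∀ i → (λ ℓ → t ℓ i) ≈[ suc i ] τ i
t≈τ 0 = ≈-cong (λ ℓ → sym (t₀ ℓ)) (λ _ → refl) (1≈0 1 (s≤s z≤n))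
t≈τ 1 = ≈-unabsorb (≈-cong (λ ℓ → sym (t₁ ℓ)) (λ _ → refl) X≈X) (1≈0 2 (s≤s z≤n))
t≈τ 2 = ≈-unabsorb (≈-cong (λ ℓ → sym (t₂ ℓ)) (λ _ → refl) Y≈Y) (1≈0 3 (s≤s z≤n))
t≈τ 3 = ≈-unabsorb {k = constant 6 ⊗ X} (≈-cong (λ ℓ → sym (t₃ ℓ)) (λ _ → refl)
  (≈-absorb (≈-scalar 4 (≈-* X≈X X≈X)) (≈-scalar 2 (1≈0 4 (s≤s z≤n))))) 6X≈0
  where
  6X≈0 : constant 6 ⊗ X ≈[ 4 ] constant 0
  6X≈0 = ≈-scalar 6 (≼-pow≈0 2 4 ≼-refl (m≤m+n 1944 8181) (m≤m+n 8 73))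
t≈τ (suc (suc (suc (suc k)))) = ≼-pow≈0 (5 + k) (5 + k)
  (length (sublists (maps (5 + k))) , λ ℓ → t≤ ℓ (4 + k)) (5+k-cubed k)
  -- The bound by the weight follows from the same inequality, as 125 ≤ 243.
  (*-cancelʳ-≤ _ _ 125 (≤-trans (*-monoʳ-≤ ((5 + k) ^ 3) (m≤m+n 125 118))
    (≤-trans (5+k-cubed k) (≤-reflexive (*-comm 125 (3 ^ (5 + k)))))))

h-bound : ∀ n → (λ ℓ → h ℓ n) ≼ z^ n
h-bound = <-rec _ step
  where
  step : ∀ n → (∀ {m} → m < n → (λ ℓ → h ℓ m) ≼ z^ m) → (λ ℓ → h ℓ n) ≼ z^ n
  step zero    ih = 1 , λ ℓ → ≤-reflexive (h₀ ℓ)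
  step (suc n) ih = let K , p = boundˡ (≈-sumSplit n {suc n} λ i j e →
                          subst (λ w → (λ ℓ → t ℓ i * h ℓ j) ≈[ w ] (λ ℓ → t ℓ i * h ℓ j)) (cong suc e)
                            (≈-* {m = suc i} {j} (≈-refl (boundˡ (t≈τ i))) (≈-refl (ih (s≤s (≤-trans (m≤n+m j i) (≤-reflexive e)))))))
                    in K , λ ℓ → subst (_≤ K * z^ (suc n) ℓ) (sym (h-recursion ℓ n)) (p ℓ)

-- The recursion, reduced to the orbits of size 2, 3 and 4

-- The binomial coefficients binom(n, 2) and binom(n, 3), by Pascal's rule.
b₂ b₃ : ℕ → ℕ
b₂ zero    = 0
b₂ (suc n) = n + b₂ n
b₃ zero    = 0
b₃ (suc n) = b₂ n + b₃ n

sumSplit-small : ∀ n f → (∀ i j → f (4 + i) j ≡ 0) →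
  sumSplit n f ≡ f 0 n + n * f 1 (n ∸ 1) + b₂ n * f 2 (n ∸ 2) + b₃ n * f 3 (n ∸ 3)
sumSplit-small zero    f p = sym (trans (+-identityʳ _) (trans (+-identityʳ _) (+-identityʳ _)))
sumSplit-small (suc n) f p = begin
  sumSplit n (f ∘ suc) + sumSplit n (λ i j → f i (suc j))
    ≡⟨ cong₂ _+_ (sumSplit-small n (f ∘ suc) (λ i → p (suc i))) (sumSplit-small n (λ i j → f i (suc j)) (λ i j → p i (suc j))) ⟩
  (f 1 n + n * f 2 (n ∸ 1) + b₂ n * f 3 (n ∸ 2) + b₃ n * f 4 (n ∸ 3)) +
  (f 0 (suc n) + n * f 1 (suc (n ∸ 1)) + b₂ n * f 2 (suc (n ∸ 2)) + b₃ n * f 3 (suc (n ∸ 3)))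
    ≡⟨ cong₂ (λ x y → f 1 n + n * f 2 (n ∸ 1) + b₂ n * f 3 (n ∸ 2) + b₃ n * x + y) (p 0 (n ∸ 3))
      (cong₂ (λ x y → x + y) (cong₂ (λ x y → f 0 (suc n) + x + y) (u₁ n) (u₂ n)) (u₃ n)) ⟩
  (f 1 n + n * f 2 (n ∸ 1) + b₂ n * f 3 (n ∸ 2) + b₃ n * 0) +
  (f 0 (suc n) + n * f 1 n + b₂ n * f 2 (n ∸ 1) + b₃ n * f 3 (n ∸ 2))
    ≡⟨ e (f 0 (suc n)) (f 1 n) (f 2 (n ∸ 1)) (f 3 (n ∸ 2)) n (b₂ n) (b₃ n) ⟩
  f 0 (suc n) + suc n * f 1 n + (n + b₂ n) * f 2 (n ∸ 1) + (b₂ n + b₃ n) * f 3 (n ∸ 2) ∎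
  where
  open ≡-Reasoning
  -- Truncation matters only for small n, where the coefficient in front vanishes.
  u₁ : ∀ n → n * f 1 (suc (n ∸ 1)) ≡ n * f 1 n
  u₁ zero    = refl
  u₁ (suc n) = refl
  u₂ : ∀ n → b₂ n * f 2 (suc (n ∸ 2)) ≡ b₂ n * f 2 (n ∸ 1)
  u₂ zero          = refl
  u₂ (suc zero)    = refl
  u₂ (suc (suc n)) = refl
  u₃ : ∀ n → b₃ n * f 3 (suc (n ∸ 3)) ≡ b₃ n * f 3 (n ∸ 2)
  u₃ zero                = refl
  u₃ (suc zero)          = refl
  u₃ (suc (suc zero))    = refl
  u₃ (suc (suc (suc n))) = refl
  e : ∀ x₀ x₁ x₂ x₃ n b c → (x₁ + n * x₂ + b * x₃ + c * 0) + (x₀ + n * x₁ + b * x₂ + c * x₃) ≡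
    x₀ + suc n * x₁ + (n + b) * x₂ + (b + c) * x₃
  e = solve-∀

H : ℕ → Seq
H n ℓ = h ℓ n

H-suc : ∀ n → H (suc n) ≈[ suc n ] constant n ⊗ (X ⊗ H (n ∸ 1)) ⊕ constant (b₂ n) ⊗ (Y ⊗ H (n ∸ 2))
  ⊕ constant (b₃ n) ⊗ (constant 4 ⊗ (X ⊗ X) ⊗ H (n ∸ 3))
H-suc n = ≈-cong (λ ℓ → sym (h-recursion ℓ n)) (λ ℓ → sumSplit-small n (λ i j → τ i ℓ * h ℓ j) (λ _ _ → refl))
  (≈-sumSplit n {suc n} λ i j e → subst (λ w → (λ ℓ → t ℓ i * h ℓ j) ≈[ w ] (λ ℓ → τ i ℓ * h ℓ j)) (cong suc e)
    (≈-* {m = suc i} {j} (t≈τ i) (≈-refl (h-bound j))))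

-- Two-term expansions

-- The coefficients of h(3m), h(3m+1), h(3m+2), h(3m-1) at the monomials with the largest and the second largest
-- power of Y.  In the expansions below h is multiplied by Y³, so that no negative power of Y occurs for small m.

α₀ α₁ β₀ β₁ γ₀ γ₁ δ₀ δ₁ : ℕ → ℕ
α₀ zero    = 1
α₀ (suc m) = b₂ (2 + m * 3) * α₀ m
α₁ zero    = 0
α₁ (suc m) = (2 + m * 3) * β₀ m + b₂ (2 + m * 3) * α₁ m + b₃ (2 + m * 3) * (4 * δ₀ m)
β₀ zero    = 0
β₀ (suc m) = (3 + m * 3) * γ₀ m + b₂ (3 + m * 3) * β₀ m + b₃ (3 + m * 3) * (4 * α₀ m)
β₁ zero    = 0
β₁ (suc m) = (3 + m * 3) * γ₁ m + b₂ (3 + m * 3) * β₁ m + b₃ (3 + m * 3) * (4 * α₁ m)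
γ₀ zero    = 1
γ₀ (suc m) = (4 + m * 3) * α₀ (suc m) + b₂ (4 + m * 3) * γ₀ m
γ₁ zero    = 0
γ₁ (suc m) = (4 + m * 3) * α₁ (suc m) + b₂ (4 + m * 3) * γ₁ m + b₃ (4 + m * 3) * (4 * β₀ m)
δ₀ zero    = 0
δ₀ (suc m) = γ₀ m
δ₁ zero    = 0
δ₁ (suc m) = γ₁ m

W : ℕ → Seq
W m ℓ = Y ℓ ^ m

-- The shapes of Y³ h at 3m, 3m + 1, 3m + 2 and 3m - 1. `D (suc m)` unfolds to `C′ m`, while `D`
-- still makes sense at m = 0.
A B C′ D : ℕ → ℕ → ℕ → Seq
A  m a b ℓ = let x = X ℓ ; y = Y ℓ ; w = W m ℓ in a * (y * (y * (y * w))) + b * (x * (x * x) * (y * w))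
B  m a b ℓ = let x = X ℓ ; y = Y ℓ ; w = W m ℓ in a * (x * x * (y * (y * w))) + b * (x * (x * (x * (x * x))) * w)
C′ m a b ℓ = let x = X ℓ ; y = Y ℓ ; w = W m ℓ in a * (x * (y * (y * (y * w)))) + b * (x * (x * (x * x)) * (y * w))
D  m a b ℓ = let x = X ℓ ; y = Y ℓ ; w = W m ℓ in a * (x * (y * (y * w))) + b * (x * (x * (x * x)) * w)

YH : ℕ → Seq
YH n = Y ⊗ (Y ⊗ Y) ⊗ H n

-- The sequence Y³ h(3m - 1), with h(-1) = 0.
YH⁻ : ℕ → Seq
YH⁻ zero    = constant 0
YH⁻ (suc m) = YH (2 + m * 3)

YH-suc : ∀ n → YH (suc n) ≈[ 10 + n ] constant n ⊗ (X ⊗ YH (n ∸ 1)) ⊕ constant (b₂ n) ⊗ (Y ⊗ YH (n ∸ 2))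
  ⊕ constant (b₃ n) ⊗ (constant 4 ⊗ (X ⊗ X) ⊗ YH (n ∸ 3))
YH-suc n = ≈-cong (λ _ → refl)
  (λ ℓ → e n (b₂ n) (b₃ n) (X ℓ) (Y ℓ) (h ℓ (n ∸ 1)) (h ℓ (n ∸ 2)) (h ℓ (n ∸ 3)))
  (≈-* (≈-* Y≈Y (≈-* Y≈Y Y≈Y)) (H-suc n))
  where
  e : ∀ n b c x y u v w → y * (y * y) * (n * (x * u) + b * (y * v) + c * (4 * (x * x) * w)) ≡
    n * (x * (y * (y * y) * u)) + b * (y * (y * (y * y) * v)) + c * (4 * (x * x) * (y * (y * y) * w))
  e = solve-∀

W≈W : ∀ m → W m ≈[ m * 3 ] W m
W≈W zero    = ≈-constant 1
W≈W (suc m) = ≈-* Y≈Y (W≈W m)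

X⁶ : Seq
X⁶ = X ⊗ (X ⊗ (X ⊗ (X ⊗ (X ⊗ X))))

-- (2⁶)³ · 3⁵ < 5³ · 3¹²: the square of the ratio 8/9 of consecutive terms is below the error 5/3^(5/3).
X⁶≈0 : X⁶ ≈[ 12 ] constant 0
X⁶≈0 = ≼-pow≈0 64 12 (≤⇒≼ λ ℓ → ≤-reflexive (sym (pow ℓ))) (m≤m+n 63700992 2729133) (m≤m+n 262144 269297)
  where
  pow : ∀ ℓ → 64 ^ ℓ ≡ X⁶ ℓ
  pow ℓ = trans (^-distribʳ-* 2 32 ℓ) (cong (2 ^ ℓ *_) (trans (^-distribʳ-* 2 16 ℓ) (cong (2 ^ ℓ *_)
    (trans (^-distribʳ-* 2 8 ℓ) (cong (2 ^ ℓ *_) (trans (^-distribʳ-* 2 4 ℓ) (cong (2 ^ ℓ *_) (^-distribʳ-* 2 2 ℓ))))))))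

X⁶⊗≈0 : ∀ {f g n} → f ≈[ n ] g → X⁶ ⊗ f ≈[ 12 + n ] constant 0
X⁶⊗≈0 p = ≈-* X⁶≈0 p

drop-X⁶ : ∀ {f g r s n} → f ≈[ 12 + n ] g ⊕ (X⁶ ⊗ r) → r ≈[ n ] s → f ≈[ 12 + n ] g
drop-X⁶ p q = ≈-sym (≈-unabsorb (≈-sym p) (X⁶⊗≈0 q))

-- The fourth field serves the orbits of size 4: h(3m + 3) refers back to h(3m - 1).
record Expansion (m : ℕ) : Set where
  constructor expansion
  field
    h⟨3m⟩   : YH (m * 3)     ≈[ 9 + m * 3 ]  A m (α₀ m) (α₁ m)
    h⟨3m+1⟩ : YH (1 + m * 3) ≈[ 10 + m * 3 ] B m (β₀ m) (β₁ m)
    h⟨3m+2⟩ : YH (2 + m * 3) ≈[ 11 + m * 3 ] C′ m (γ₀ m) (γ₁ m)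
    h⟨3m-1⟩ : YH⁻ m          ≈[ 8 + m * 3 ]  D m (δ₀ m) (δ₁ m)

private
  step-A : ∀ m → Expansion m → YH (3 + m * 3) ≈[ 12 + m * 3 ] A (suc m) (α₀ (suc m)) (α₁ (suc m))
  step-A m (expansion a b c d) = drop-X⁶ {r = constant (n * β₁ m + b₃ n * (4 * δ₁ m)) ⊗ W m}
    (≈-trans (≈-cong (λ _ → refl) (shift m) (YH-suc n))
      (≈-cong (λ _ → refl) (λ ℓ → e n (b₂ n) (b₃ n) (X ℓ) (Y ℓ) (W m ℓ) (α₀ m) (α₁ m) (β₀ m) (β₁ m) (δ₀ m) (δ₁ m))
        (≈-+ (≈-+ (≈-scalar n (≈-* X≈X b)) (≈-scalar (b₂ n) (≈-* Y≈Y a)))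
          (≈-scalar (b₃ n) (≈-* (≈-scalar 4 (≈-* X≈X X≈X)) d)))))
    (≈-scalar (n * β₁ m + b₃ n * (4 * δ₁ m)) (W≈W m))
    where
    n = 2 + m * 3
    shift : ∀ m ℓ → let n = 2 + m * 3 in
      (constant n ⊗ (X ⊗ YH (n ∸ 1)) ⊕ constant (b₂ n) ⊗ (Y ⊗ YH (n ∸ 2)) ⊕ constant (b₃ n) ⊗ (constant 4 ⊗ (X ⊗ X) ⊗ YH (n ∸ 3))) ℓ
      ≡ (constant n ⊗ (X ⊗ YH (1 + m * 3)) ⊕ constant (b₂ n) ⊗ (Y ⊗ YH (m * 3)) ⊕ constant (b₃ n) ⊗ (constant 4 ⊗ (X ⊗ X) ⊗ YH⁻ m)) ℓ
    -- Here `n ∸ 3` truncates and gives `YH 0` in place of zero, but the coefficient `b₃ 2` is 0.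
    shift zero    ℓ = refl
    shift (suc m) ℓ = refl
    e : ∀ n b c x y w a a′ d d′ f f′ →
      n * (x * (d * (x * x * (y * (y * w))) + d′ * (x * (x * (x * (x * x))) * w)))
      + b * (y * (a * (y * (y * (y * w))) + a′ * (x * (x * x) * (y * w))))
      + c * (4 * (x * x) * (f * (x * (y * (y * w))) + f′ * (x * (x * (x * x)) * w)))
      ≡ (b * a) * (y * (y * (y * (y * w)))) + (n * d + b * a′ + c * (4 * f)) * (x * (x * x) * (y * (y * w)))
        + x * (x * (x * (x * (x * x)))) * ((n * d′ + c * (4 * f′)) * w)
    e = solve-∀

  -- Every term has X to the power 2 or 5, so in contrast to the other two steps no monomial is
  -- dropped.
  step-B : ∀ m → Expansion m → YH (4 + m * 3) ≈[ 13 + m * 3 ] B (suc m) (β₀ (suc m)) (β₁ (suc m))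
  step-B m (expansion a b c d) = ≈-trans (YH-suc n)
      (≈-cong (λ _ → refl) (λ ℓ → e n (b₂ n) (b₃ n) (X ℓ) (Y ℓ) (W m ℓ) (α₀ m) (α₁ m) (β₀ m) (β₁ m) (γ₀ m) (γ₁ m))
        (≈-+ (≈-+ (≈-scalar n (≈-* X≈X c)) (≈-scalar (b₂ n) (≈-* Y≈Y b)))
          (≈-scalar (b₃ n) (≈-* (≈-scalar 4 (≈-* X≈X X≈X)) a))))
    where
    n = 3 + m * 3
    e : ∀ n b c x y w a a′ d d′ f f′ →
      n * (x * (f * (x * (y * (y * (y * w)))) + f′ * (x * (x * (x * x)) * (y * w))))
      + b * (y * (d * (x * x * (y * (y * w))) + d′ * (x * (x * (x * (x * x))) * w)))
      + c * (4 * (x * x) * (a * (y * (y * (y * w))) + a′ * (x * (x * x) * (y * w))))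
      ≡ (n * f + b * d + c * (4 * a)) * (x * x * (y * (y * (y * w))))
        + (n * f′ + b * d′ + c * (4 * a′)) * (x * (x * (x * (x * x))) * (y * w))
    e = solve-∀

  step-C : ∀ m → Expansion m → YH (5 + m * 3) ≈[ 14 + m * 3 ] C′ (suc m) (γ₀ (suc m)) (γ₁ (suc m))
  step-C m ex@(expansion a b c d) = drop-X⁶ {r = constant (b₃ n * (4 * β₁ m)) ⊗ (X ⊗ W m)}
    (≈-trans (YH-suc n)
      (≈-cong (λ _ → refl) (λ ℓ → e n (b₂ n) (b₃ n) (X ℓ) (Y ℓ) (W m ℓ) (α₀ (suc m)) (α₁ (suc m)) (β₀ m) (β₁ m) (γ₀ m) (γ₁ m))
        (≈-+ (≈-+ (≈-scalar n (≈-* X≈X (step-A m ex))) (≈-scalar (b₂ n) (≈-* Y≈Y c)))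
          (≈-scalar (b₃ n) (≈-* (≈-scalar 4 (≈-* X≈X X≈X)) b)))))
    (≈-scalar (b₃ n * (4 * β₁ m)) (≈-* X≈X (W≈W m)))
    where
    n = 4 + m * 3
    e : ∀ n b c x y w a a′ d d′ f f′ →
      n * (x * (a * (y * (y * (y * (y * w)))) + a′ * (x * (x * x) * (y * (y * w)))))
      + b * (y * (f * (x * (y * (y * (y * w)))) + f′ * (x * (x * (x * x)) * (y * w))))
      + c * (4 * (x * x) * (d * (x * x * (y * (y * w))) + d′ * (x * (x * (x * (x * x))) * w)))
      ≡ (n * a + b * f) * (x * (y * (y * (y * (y * w))))) + (n * a′ + b * f′ + c * (4 * d)) * (x * (x * (x * x)) * (y * (y * w)))
        + x * (x * (x * (x * (x * x)))) * (c * (4 * d′) * (x * w))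
    e = solve-∀

Y³≈Y³ : Y ⊗ (Y ⊗ Y) ≈[ 9 ] Y ⊗ (Y ⊗ Y)
Y³≈Y³ = ≈-* Y≈Y (≈-* Y≈Y Y≈Y)

expand : ∀ m → Expansion m
expand zero = expansion
  (≈-cong (λ ℓ → cong (Y ℓ * (Y ℓ * Y ℓ) *_) (sym (h₀ ℓ))) (λ ℓ → e (Y ℓ)) (≈-* Y³≈Y³ (≈-constant 1)))
  -- h(1) = 1 is negligible at weight 1, hence the zeros `β₀ 0` and `β₁ 0`.
  (≈-cong (λ ℓ → cong (Y ℓ * (Y ℓ * Y ℓ) *_) (sym (h₁ ℓ))) (λ ℓ → *-zeroʳ (Y ℓ * (Y ℓ * Y ℓ))) (≈-* Y³≈Y³ (1≈0 1 (s≤s z≤n))))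
  (≈-cong (λ ℓ → cong (Y ℓ * (Y ℓ * Y ℓ) *_) (sym (h₂ ℓ))) (λ ℓ → e′ (X ℓ) (Y ℓ)) (≈-* Y³≈Y³ X≈X))
  (≈-refl (0 , λ _ → z≤n))
  where
  e : ∀ y → y * (y * y) * 1 ≡ 1 * (y * (y * (y * 1))) + 0
  e = solve-∀
  e′ : ∀ x y → y * (y * y) * x ≡ 1 * (x * (y * (y * (y * 1)))) + 0
  e′ = solve-∀
expand (suc m) = let ex = expand m in
  expansion (step-A m ex) (step-B m ex) (step-C m ex) (Expansion.h⟨3m+2⟩ ex)

-- Closed forms of the leading coefficients

2b₂ : ∀ n → 2 * b₂ (suc n) ≡ suc n * n
2b₂ zero    = refl
2b₂ (suc n) = trans (e n (b₂ (suc n))) (trans (cong (2 * suc n +_) (2b₂ n)) (e′ n))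
  where
  e : ∀ n b → 2 * (suc n + b) ≡ 2 * suc n + 2 * b
  e = solve-∀
  e′ : ∀ n → 2 * suc n + suc n * n ≡ suc (suc n) * suc n
  e′ = solve-∀

6b₃ : ∀ n → 6 * b₃ (2 + n) ≡ (2 + n) * (1 + n) * n
6b₃ zero    = refl
6b₃ (suc n) = trans (e (b₂ (2 + n)) (b₃ (2 + n))) (trans (cong₂ (λ x y → 3 * x + y) (2b₂ (suc n)) (6b₃ n)) (e′ n))
  where
  e : ∀ b c → 6 * (b + c) ≡ 3 * (2 * b) + 6 * c
  e = solve-∀
  e′ : ∀ n → 3 * (suc (suc n) * suc n) + (2 + n) * (1 + n) * n ≡ (2 + suc n) * (1 + suc n) * suc n
  e′ = solve-∀

-- α₀(m + 1) counts the partitions of 3m + 3 points into triples; deleting one point leaves a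
-- partition of 3m + 2 points into triples and one pair, which γ₀(m) counts. The calculation is
-- Pascal's rule for `b₂`.
γ₀≡α₀ : ∀ m → γ₀ m ≡ α₀ (suc m)
γ₀≡α₀ zero    = refl
γ₀≡α₀ (suc m) = trans (cong (λ g → (4 + m * 3) * α₀ (suc m) + b₂ (4 + m * 3) * g) (γ₀≡α₀ m))
  (sym (*-distribʳ-+ (α₀ (suc m)) (4 + m * 3) (b₂ (4 + m * 3))))

-- The 7 is 3 + 4: besides m - 1 triples, the 3m + 1 points form either two pairs, in 3/4 m (3m + 1)
-- α₀(m) ways, or one quadruple, which carries the factor 4 of 4X² and contributes m (3m + 1) α₀(m).
4β₀ : ∀ m → 4 * β₀ m ≡ 7 * m * (1 + m * 3) * α₀ m
4β₀ zero    = refl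
-- The factor 6 clears the denominators of `b₂` and `b₃`.
4β₀ (suc m) = *-cancelˡ-≡ _ _ 6 (begin
  6 * (4 * (k * γ₀ m + b₂ k * β₀ m + b₃ k * (4 * a)))
    ≡⟨ cong (λ g → 6 * (4 * (k * g + b₂ k * β₀ m + b₃ k * (4 * a)))) (γ₀≡α₀ m) ⟩
  6 * (4 * (k * (b₂ (2 + m * 3) * a) + b₂ k * β₀ m + b₃ k * (4 * a)))
    ≡⟨ e₁ k (b₂ (2 + m * 3)) (b₂ k) (b₃ k) a (β₀ m) ⟩
  12 * k * (2 * b₂ (2 + m * 3)) * a + 3 * (2 * b₂ k) * (4 * β₀ m) + 16 * (6 * b₃ k) * a
    ≡⟨ cong₂ _+_ (cong₂ (λ p q → 12 * k * p * a + 3 * (2 * b₂ k) * q) (2b₂ (1 + m * 3)) (4β₀ m)) (cong (λ q → 16 * q * a) (6b₃ (1 + m * 3))) ⟩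
  12 * k * ((2 + m * 3) * (1 + m * 3)) * a + 3 * (2 * b₂ k) * (7 * m * (1 + m * 3) * a) + 16 * ((3 + m * 3) * (2 + m * 3) * (1 + m * 3)) * a
    ≡⟨ cong (λ p → 12 * k * ((2 + m * 3) * (1 + m * 3)) * a + 3 * p * (7 * m * (1 + m * 3) * a) + 16 * ((3 + m * 3) * (2 + m * 3) * (1 + m * 3)) * a) (2b₂ (2 + m * 3)) ⟩
  12 * k * ((2 + m * 3) * (1 + m * 3)) * a + 3 * ((3 + m * 3) * (2 + m * 3)) * (7 * m * (1 + m * 3) * a) + 16 * ((3 + m * 3) * (2 + m * 3) * (1 + m * 3)) * a
    ≡⟨ e₂ m a ⟩
  21 * suc m * (4 + m * 3) * ((2 + m * 3) * (1 + m * 3) * a)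
    ≡⟨ cong (λ p → 21 * suc m * (4 + m * 3) * (p * a)) (2b₂ (1 + m * 3)) ⟨
  21 * suc m * (4 + m * 3) * (2 * b₂ (2 + m * 3) * a)
    ≡⟨ e₃ m (b₂ (2 + m * 3)) a ⟩
  6 * (7 * suc m * (1 + suc m * 3) * (b₂ (2 + m * 3) * a)) ∎)
  where
  open ≡-Reasoning
  k = 3 + m * 3
  a = α₀ m
  e₁ : ∀ k p q r a b → 6 * (4 * (k * (p * a) + q * b + r * (4 * a))) ≡ 12 * k * (2 * p) * a + 3 * (2 * q) * (4 * b) + 16 * (6 * r) * a
  e₁ = solve-∀
  e₂ : ∀ m a → 12 * (3 + m * 3) * ((2 + m * 3) * (1 + m * 3)) * a + 3 * ((3 + m * 3) * (2 + m * 3)) * (7 * m * (1 + m * 3) * a)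
    + 16 * ((3 + m * 3) * (2 + m * 3) * (1 + m * 3)) * a ≡ 21 * suc m * (4 + m * 3) * ((2 + m * 3) * (1 + m * 3) * a)
  e₂ = solve-∀
  e₃ : ∀ m p a → 21 * suc m * (4 + m * 3) * (2 * p * a) ≡ 6 * (7 * suc m * (1 + suc m * 3) * (p * a))
  e₃ = solve-∀

2[3m+2]β₀ : ∀ m → 2 * ((2 + m * 3) * β₀ m) ≡ 7 * m * α₀ (suc m)
2[3m+2]β₀ m = *-cancelˡ-≡ _ _ 2 (begin
  2 * (2 * ((2 + m * 3) * β₀ m))                          ≡⟨ e₁ m (β₀ m) ⟩
  (2 + m * 3) * (4 * β₀ m)                                ≡⟨ cong ((2 + m * 3) *_) (4β₀ m) ⟩
  (2 + m * 3) * (7 * m * (1 + m * 3) * α₀ m)              ≡⟨ e₂ m (α₀ m) ⟩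
  7 * m * ((2 + m * 3) * (1 + m * 3) * α₀ m)              ≡⟨ cong (λ p → 7 * m * (p * α₀ m)) (2b₂ (1 + m * 3)) ⟨
  7 * m * (2 * b₂ (2 + m * 3) * α₀ m)                     ≡⟨ e₃ m (b₂ (2 + m * 3)) (α₀ m) ⟩
  2 * (7 * m * (b₂ (2 + m * 3) * α₀ m))                   ∎)
  where
  open ≡-Reasoning
  e₁ : ∀ m b → 2 * (2 * ((2 + m * 3) * b)) ≡ (2 + m * 3) * (4 * b)
  e₁ = solve-∀
  e₂ : ∀ m a → (2 + m * 3) * (7 * m * (1 + m * 3) * a) ≡ 7 * m * ((2 + m * 3) * (1 + m * 3) * a)
  e₂ = solve-∀
  e₃ : ∀ m p a → 7 * m * (2 * p * a) ≡ 2 * (7 * m * (p * a))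
  e₃ = solve-∀

α₀>0 : ∀ m → 0 < α₀ m
α₀>0 zero    = s≤s z≤n
α₀>0 (suc m) = *-mono-< {0} {b₂ (2 + m * 3)} (s≤s z≤n) (α₀>0 m)

-- The counts N, up to the error of the integer division

F : ℕ → Seq
F n ℓ = n ! * N ℓ n

-- The remainder of the division is below n!, hence bounded in ℓ, and constants are negligible from
-- weight 1 on.
F≈H : ∀ n → 1 ≤ n → F n ≈[ n ] H n
F≈H n 1≤n = ≈-unabsorb {k = λ ℓ → (h ℓ n % n !) {{n !≢0}}}
  (≈-cong split (λ _ → refl) (≈-refl (h-bound n)))
  (bounded≈0 1≤n λ ℓ → <⇒≤ (m%n<n (h ℓ n) (n !) {{n !≢0}}))
  where
  split : ∀ ℓ → h ℓ n ≡ n ! * N ℓ n + (h ℓ n % n !) {{n !≢0}}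
  split ℓ = trans (m≡m%n+[m/n]*n (h ℓ n) (n !) {{n !≢0}})
    (trans (+-comm _ (N ℓ n * n !)) (cong (_+ (h ℓ n % n !) {{n !≢0}}) (*-comm (N ℓ n) (n !))))

YF : ℕ → Seq
YF n = Y ⊗ (Y ⊗ Y) ⊗ F n

YF≈ : ∀ {n f} → 1 ≤ n → YH n ≈[ 9 + n ] f → YF n ≈[ 9 + n ] f
YF≈ {n} 1≤n p = ≈-trans (≈-* Y³≈Y³ (F≈H n 1≤n)) p

-- Comparing expansions

_∧ᶜ_ : ∀ {P Q : ℕ → Set} → Cofinitely P → Cofinitely Q → Cofinitely (λ ℓ → P ℓ × Q ℓ)
(K , p) ∧ᶜ (L , q) = K + L , λ ℓ le → p ℓ (≤-trans (m≤m+n K L) le) , q ℓ (≤-trans (m≤n+m L K) le)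

mapᶜ : ∀ {P Q : ℕ → Set} → (∀ ℓ → P ℓ → Q ℓ) → Cofinitely P → Cofinitely Q
mapᶜ f (K , p) = K , λ ℓ le → f ℓ (p ℓ le)

≈-compare : ∀ {w U V P Q M} → U ≈[ w ] P → V ≈[ w ] Q → Cofinitely (λ ℓ → P ℓ + M ℓ ≤ Q ℓ) →
  scale 5 w ≪ M ⊗ z^ 5 → Cofinitely (λ ℓ → U ℓ < V ℓ)
≈-compare {w} {U} {V} {P} {Q} {M} u v pq small with lower u | upper v
-- `K` and `L` bound the two errors; the additional 1 leaves one copy of `scale 5 w` over, which
-- makes the inequality strict.
... | K , p | L , q = mapᶜ step (pq ∧ᶜ small (K + L + 1))
  where
  open ≤-Reasoning
  e₁ : ∀ x s l → x + s + l * s ≡ x + l * s + s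
  e₁ = solve-∀
  e₂ : ∀ x s k l → x + k * s + l * s + s ≡ x + (k + l + 1) * s
  e₂ = solve-∀
  step : ∀ ℓ → P ℓ + M ℓ ≤ Q ℓ × (K + L + 1) * scale 5 w ℓ ≤ M ℓ * z^ 5 ℓ → U ℓ < V ℓ
  step ℓ (le , sm) = *-cancelʳ-< (z^ 5 ℓ) (U ℓ) (V ℓ) (<-≤-trans (m<m+n _ s>0) (+-cancelʳ-≤ (L * s) _ _ (begin
    U ℓ * u₅ + s + L * s                  ≡⟨ e₁ (U ℓ * u₅) s L ⟩
    U ℓ * u₅ + L * s + s                  ≤⟨ +-monoˡ-≤ s (+-monoˡ-≤ (L * s) (p ℓ)) ⟩
    P ℓ * u₅ + K * s + L * s + s          ≡⟨ e₂ (P ℓ * u₅) s K L ⟩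
    P ℓ * u₅ + (K + L + 1) * s            ≤⟨ +-monoʳ-≤ (P ℓ * u₅) sm ⟩
    P ℓ * u₅ + M ℓ * u₅                   ≡⟨ *-distribʳ-+ u₅ (P ℓ) (M ℓ) ⟨
    (P ℓ + M ℓ) * u₅                      ≤⟨ *-monoˡ-≤ u₅ le ⟩
    Q ℓ * u₅                              ≤⟨ q ℓ ⟩
    V ℓ * u₅ + L * s                      ∎)))
    where
    s = scale 5 w ℓ
    u₅ = z^ 5 ℓ
    s>0 : 0 < s
    s>0 = *-mono-< {0} {5 ^ ℓ} (m^n>0 5 ℓ) (m^n>0 (z ℓ) {{>-nonZero (z>0 ℓ)}} w)

Lex : ℕ → ℕ → ℕ → ℕ → Set
Lex u₀ u₁ v₀ v₁ = u₀ < v₀ ⊎ (u₀ ≡ v₀ × u₁ < v₁)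

-- The gap is one copy of the smaller monomial `M₁`, the margin that `≈-compare` sets against the
-- error. If the leading coefficients differ, a single `M₀` pays for it.
lex-eventually : ∀ {u₀ u₁ v₀ v₁ M₀ M₁} → M₁ ≪ M₀ → Lex u₀ u₁ v₀ v₁ →
  Cofinitely (λ ℓ → u₀ * M₀ ℓ + u₁ * M₁ ℓ + M₁ ℓ ≤ v₀ * M₀ ℓ + v₁ * M₁ ℓ)
lex-eventually {u₀} {u₁} {v₀} {v₁} {M₀} {M₁} dom (inj₁ lt) = mapᶜ step (dom (u₁ + 1))
  where
  open ≤-Reasoning
  e : ∀ x y m u → u * x + y * m + m ≡ u * x + (y + 1) * m
  e = solve-∀
  e′ : ∀ u x → u * x + x ≡ suc u * x
  e′ = solve-∀
  step : ∀ ℓ → (u₁ + 1) * M₁ ℓ ≤ M₀ ℓ → u₀ * M₀ ℓ + u₁ * M₁ ℓ + M₁ ℓ ≤ v₀ * M₀ ℓ + v₁ * M₁ ℓ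
  step ℓ le = begin
    u₀ * M₀ ℓ + u₁ * M₁ ℓ + M₁ ℓ    ≡⟨ e (M₀ ℓ) u₁ (M₁ ℓ) u₀ ⟩
    u₀ * M₀ ℓ + (u₁ + 1) * M₁ ℓ     ≤⟨ +-monoʳ-≤ (u₀ * M₀ ℓ) le ⟩
    u₀ * M₀ ℓ + M₀ ℓ                ≡⟨ e′ u₀ (M₀ ℓ) ⟩
    suc u₀ * M₀ ℓ                   ≤⟨ *-monoˡ-≤ (M₀ ℓ) lt ⟩
    v₀ * M₀ ℓ                       ≤⟨ m≤m+n _ _ ⟩
    v₀ * M₀ ℓ + v₁ * M₁ ℓ           ∎
lex-eventually {u₀} {u₁} {v₀} {v₁} {M₀} {M₁} dom (inj₂ (refl , lt)) = 0 , λ ℓ _ → begin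
    u₀ * M₀ ℓ + u₁ * M₁ ℓ + M₁ ℓ    ≡⟨ e (M₀ ℓ) u₁ (M₁ ℓ) u₀ ⟩
    u₀ * M₀ ℓ + suc u₁ * M₁ ℓ       ≤⟨ +-monoʳ-≤ (u₀ * M₀ ℓ) (*-monoˡ-≤ (M₁ ℓ) lt) ⟩
    u₀ * M₀ ℓ + v₁ * M₁ ℓ           ∎
  where
  open ≤-Reasoning
  e : ∀ x y m u → u * x + y * m + m ≡ u * x + suc y * m
  e = solve-∀

≪-⊗-≼ : ∀ {f g a b} → f ≪ g → a ≼ b → f ⊗ a ≪ g ⊗ b
≪-⊗-≼ {f} {g} {a} {b} fg (A , p) K = mapᶜ step (fg (K * A))
  where
  open ≤-Reasoning
  e : ∀ k f c b → k * (f * (c * b)) ≡ k * c * f * b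
  e = solve-∀
  step : ∀ ℓ → K * A * f ℓ ≤ g ℓ → K * (f ℓ * a ℓ) ≤ g ℓ * b ℓ
  step ℓ le = begin
    K * (f ℓ * a ℓ)         ≤⟨ *-monoʳ-≤ K (*-monoʳ-≤ (f ℓ) (p ℓ)) ⟩
    K * (f ℓ * (A * b ℓ))   ≡⟨ e K (f ℓ) A (b ℓ) ⟩
    K * A * f ℓ * b ℓ       ≤⟨ *-monoˡ-≤ (b ℓ) le ⟩
    g ℓ * b ℓ               ∎

≪-cong : ∀ {f f′ g g′} → (∀ ℓ → f ℓ ≡ f′ ℓ) → (∀ ℓ → g ℓ ≡ g′ ℓ) → f ≪ g → f′ ≪ g′
≪-cong e e′ p K = mapᶜ (λ ℓ → subst₂ (λ x y → K * x ≤ y) (e ℓ) (e′ ℓ)) (p K)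

8^ : ∀ ℓ → 8 ^ ℓ ≡ X ℓ * (X ℓ * X ℓ)
8^ ℓ = trans (^-distribʳ-* 2 4 ℓ) (cong (2 ^ ℓ *_) (^-distribʳ-* 2 2 ℓ))

X³≪Y² : X ⊗ (X ⊗ X) ≪ Y ⊗ Y
X³≪Y² = ≪-cong 8^ (λ ℓ → ^-distribʳ-* 3 3 ℓ) (^-≪ (n<1+n 8))

tail : ℕ → Seq
tail m = W m ⊗ W m

z³≼Y : z^ 3 ≼ Y
z³≼Y = 3 , z³≤

z^≼W : ∀ m → z^ (m * 3) ≼ W m
z^≼W zero    = ≼-refl
z^≼W (suc m) = ≼-trans (≤⇒≼ λ ℓ → ≤-reflexive (^-distribˡ-+-* (z ℓ) 3 (m * 3))) (≼-* z³≼Y (z^≼W m))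

z^≼tail : ∀ m → z^ (m * 3 + m * 3) ≼ tail m
z^≼tail m = ≼-trans (≤⇒≼ λ ℓ → ≤-reflexive (^-distribˡ-+-* (z ℓ) (m * 3) (m * 3))) (≼-* (z^≼W m) (z^≼W m))

z^≼Y⊗ : ∀ n {f} → z^ n ≼ f → z^ (3 + n) ≼ Y ⊗ f
z^≼Y⊗ n p = ≼-trans (≤⇒≼ λ ℓ → ≤-reflexive (^-distribˡ-+-* (z ℓ) 3 n)) (≼-* z³≼Y p)

-- The margin splits into B^ℓ, a power of X, and a part `f` of full size z^q. What remains is
-- 5/3^(5/3) < B/3^(i/3), cubed.
error≪ : ∀ i B q {M f} → 5 ^ 3 * 3 ^ i < B ^ 3 * 3 ^ 5 → z^ q ≼ f → (∀ ℓ → B ^ ℓ * f ℓ ≡ M ℓ) →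
  scale 5 (i + q) ≪ M ⊗ z^ 5
error≪ i B q {M} {f} lt p e = ≪-cong (λ ℓ → scale-* i q ℓ)
  (λ ℓ → trans (swap (B ^ ℓ) (z^ 5 ℓ) (f ℓ)) (cong (_* z^ 5 ℓ) (e ℓ)))
  (≪-⊗-≼ (scale-≪ 5 i B 5 lt) p)
  where
  swap : ∀ b u f → b * u * f ≡ b * f * u
  swap = solve-∀

-- Second-order expansions of n N(n-1) N(n+1) and (n+1) N(n)²

reweight : ∀ {a b k f g} → f ≈[ (a + k) + (b + k) ] g → f ≈[ (a + b) + (k + k) ] g
reweight {a} {b} {k} {f} {g} = subst (λ w → f ≈[ w ] g) (e a b k)
  where
  e : ∀ a b k → (a + k) + (b + k) ≡ (a + b) + (k + k)
  e = solve-∀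

T≈T : ∀ m → tail m ≈[ m * 3 + m * 3 ] tail m
T≈T m = ≈-* (W≈W m) (W≈W m)

-- As n (n-1)! (n+1)! = (n+1) (n!)², these are N(n)² and N(n-1) N(n+1) times the same factor.
Square Neighbours : ℕ → Seq
Square n     = constant (suc n) ⊗ (YF n ⊗ YF n)
Neighbours n = constant n ⊗ (YF (pred n) ⊗ YF (suc n))

M₀ M₁ : Seq → Seq
M₀ f = Y ⊗ Y ⊗ f
M₁ f = X ⊗ (X ⊗ X) ⊗ f

M₁≪M₀ : ∀ f → M₁ f ≪ M₀ f
M₁≪M₀ f = ≪-⊗-≼ X³≪Y² (≼-refl {f})

infix 4 _≈⟨_,_,_⟩_
record _≈⟨_,_,_⟩_ (U : Seq) (w c d : ℕ) (f : Seq) : Set where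
  constructor two-terms
  field
    expanded : U ≈[ w ] constant c ⊗ M₀ f ⊕ constant d ⊗ M₁ f

≈⟨⟩-compare : ∀ {w f U V u₀ u₁ v₀ v₁} → U ≈⟨ w , u₀ , u₁ ⟩ f → V ≈⟨ w , v₀ , v₁ ⟩ f → Lex u₀ u₁ v₀ v₁ →
  scale 5 w ≪ M₁ f ⊗ z^ 5 → Cofinitely (λ ℓ → U ℓ < V ℓ)
≈⟨⟩-compare {f = f} (two-terms p) (two-terms q) lex = ≈-compare p q (lex-eventually (M₁≪M₀ f) lex)

module _ (m : ℕ) where

  private
    k = m * 3
    a  = α₀ (suc m)
    a′ = α₁ (suc m)
    b  = β₀ m
    b′ = β₁ m
    b⁺ = β₀ (suc m)
    b⁺′ = β₁ (suc m)
    c  = γ₀ m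
    c′ = γ₁ m
    c⁺ = γ₀ (suc m)
    c⁺′ = γ₁ (suc m)
    open Expansion

    fA : YF (3 + k) ≈[ 12 + k ] A (suc m) a a′
    fA = YF≈ (s≤s z≤n) (h⟨3m⟩ (expand (suc m)))
    fB : YF (1 + k) ≈[ 10 + k ] B m b b′
    fB = YF≈ (s≤s z≤n) (h⟨3m+1⟩ (expand m))
    fB⁺ : YF (4 + k) ≈[ 13 + k ] B (suc m) b⁺ b⁺′
    fB⁺ = YF≈ (s≤s z≤n) (h⟨3m+1⟩ (expand (suc m)))
    fC : YF (2 + k) ≈[ 11 + k ] C′ m c c′
    fC = YF≈ (s≤s z≤n) (h⟨3m+2⟩ (expand m))
    fC⁺ : YF (5 + k) ≈[ 14 + k ] C′ (suc m) c⁺ c⁺′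
    fC⁺ = YF≈ (s≤s z≤n) (h⟨3m+2⟩ (expand (suc m)))

    -- For each residue class, the common factor of the two visible monomials, which are Y² and X³
    -- times it.
    Q₀ Q₁ Q₂ : Seq
    Q₀ = Y ⊗ (Y ⊗ (Y ⊗ (Y ⊗ (Y ⊗ (Y ⊗ tail m)))))
    Q₁ = X ⊗ Q₀
    Q₂ = X ⊗ (X ⊗ (Y ⊗ (Y ⊗ (Y ⊗ (Y ⊗ tail m)))))

    Y²T : Y ⊗ (Y ⊗ tail m) ≈[ 6 + (k + k) ] Y ⊗ (Y ⊗ tail m)
    Y²T = ≈-* Y≈Y (≈-* Y≈Y (T≈T m))
    Y⁴T : Y ⊗ (Y ⊗ (Y ⊗ (Y ⊗ tail m))) ≈[ 12 + (k + k) ] Y ⊗ (Y ⊗ (Y ⊗ (Y ⊗ tail m)))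
    Y⁴T = ≈-* Y≈Y (≈-* Y≈Y Y²T)

    z^≼Q : z^ (12 + (k + k)) ≼ Y ⊗ (Y ⊗ (Y ⊗ (Y ⊗ tail m)))
    z^≼Q = z^≼Y⊗ (9 + (k + k)) (z^≼Y⊗ (6 + (k + k)) (z^≼Y⊗ (3 + (k + k)) (z^≼Y⊗ (k + k) (z^≼tail m))))
    z^≼Q₀ : z^ (18 + (k + k)) ≼ Q₀
    z^≼Q₀ = z^≼Y⊗ (15 + (k + k)) (z^≼Y⊗ (12 + (k + k)) z^≼Q)

  -- In the three cases the margin contains X³, X⁴ and X⁵, with rates 0.888..., 0.854... and
  -- 0.821..., all above the error rate 0.801... .
  error₀ : scale 5 (24 + (k + k)) ≪ M₁ Q₀ ⊗ z^ 5
  error₀ = error≪ 6 8 (18 + (k + k)) (m≤m+n 91126 33290) z^≼Q₀ (λ ℓ → cong (_* Q₀ ℓ) (8^ ℓ))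

  error₁ : scale 5 (26 + (k + k)) ≪ M₁ Q₁ ⊗ z^ 5
  error₁ = error≪ 8 16 (18 + (k + k)) (m≤m+n 820126 175202) z^≼Q₀
    (λ ℓ → trans (cong (_* Q₀ ℓ) (trans (^-distribʳ-* 2 8 ℓ) (cong (X ℓ *_) (8^ ℓ)))) (e (X ℓ) (Q₀ ℓ)))
    where
    e : ∀ x q → x * (x * (x * x)) * q ≡ x * (x * x) * (x * q)
    e = solve-∀

  error₂ : scale 5 (22 + (k + k)) ≪ M₁ Q₂ ⊗ z^ 5
  error₂ = error≪ 10 32 (12 + (k + k)) (m≤m+n 7381126 581498) z^≼Q
    (λ ℓ → trans (cong (_* q ℓ) (trans (^-distribʳ-* 2 16 ℓ) (cong (X ℓ *_) (trans (^-distribʳ-* 2 8 ℓ) (cong (X ℓ *_) (8^ ℓ))))))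
      (e (X ℓ) (q ℓ)))
    where
    q = Y ⊗ (Y ⊗ (Y ⊗ (Y ⊗ tail m)))
    e : ∀ x q → x * (x * (x * (x * x))) * q ≡ x * (x * x) * (x * (x * q))
    e = solve-∀

  square₀ : Square (3 + k) ≈⟨ 24 + (k + k) , (4 + k) * (a * a) , (4 + k) * (2 * (a * a′)) ⟩ Q₀
  square₀ = two-terms (drop-X⁶ {r = constant ((4 + k) * (a′ * a′)) ⊗ (Y ⊗ (Y ⊗ (Y ⊗ (Y ⊗ tail m))))}
    (≈-cong (λ _ → refl) (λ ℓ → e (4 + k) a a′ (X ℓ) (Y ℓ) (W m ℓ)) (≈-scalar (4 + k) (reweight {12} {12} {k} (≈-* fA fA))))
    (≈-scalar ((4 + k) * (a′ * a′)) Y⁴T))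
    where
    e : ∀ n a a′ x y w → let p = a * (y * (y * (y * (y * w)))) + a′ * (x * (x * x) * (y * (y * w))) in
      n * (p * p) ≡
      n * (a * a) * (y * y * (y * (y * (y * (y * (y * (y * (w * w)))))))) +
      n * (2 * (a * a′)) * (x * (x * x) * (y * (y * (y * (y * (y * (y * (w * w)))))))) +
      x * (x * (x * (x * (x * x)))) * (n * (a′ * a′) * (y * (y * (y * (y * (w * w))))))
    e = solve-∀

  neighbours₀ : Neighbours (3 + k) ≈⟨ 24 + (k + k) , 0 , (3 + k) * (c * b⁺) ⟩ Q₀
  neighbours₀ = two-terms (drop-X⁶ {r = constant ((3 + k) * (c * b⁺′ + c′ * b⁺)) ⊗ (Y ⊗ (Y ⊗ (Y ⊗ (Y ⊗ tail m))))
      ⊕ constant ((3 + k) * (c′ * b⁺′)) ⊗ (X ⊗ (X ⊗ (X ⊗ (Y ⊗ (Y ⊗ tail m)))))}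
    (≈-cong (λ _ → refl) (λ ℓ → e (3 + k) c c′ b⁺ b⁺′ (X ℓ) (Y ℓ) (W m ℓ)) (≈-scalar (3 + k) (reweight {11} {13} {k} (≈-* fC fB⁺))))
    (≈-+ (≈-scalar ((3 + k) * (c * b⁺′ + c′ * b⁺)) Y⁴T)
      (≈-scalar ((3 + k) * (c′ * b⁺′)) (≈-* X≈X (≈-* X≈X (≈-* X≈X Y²T))))))
    where
    e : ∀ n c c′ b b′ x y w → let p = c * (x * (y * (y * (y * w)))) + c′ * (x * (x * (x * x)) * (y * w))
                                  q = b * (x * x * (y * (y * (y * w)))) + b′ * (x * (x * (x * (x * x))) * (y * w)) in
      n * (p * q) ≡
      0 + n * (c * b) * (x * (x * x) * (y * (y * (y * (y * (y * (y * (w * w)))))))) +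
      x * (x * (x * (x * (x * x)))) * (n * (c * b′ + c′ * b) * (y * (y * (y * (y * (w * w))))) + n * (c′ * b′) * (x * (x * (x * (y * (y * (w * w)))))))
    e = solve-∀

  square₁ : Square (4 + k) ≈⟨ 26 + (k + k) , 0 , (5 + k) * (b⁺ * b⁺) ⟩ Q₁
  square₁ = two-terms (drop-X⁶ {r = constant ((5 + k) * (2 * (b⁺ * b⁺′))) ⊗ (X ⊗ (Y ⊗ (Y ⊗ (Y ⊗ (Y ⊗ tail m)))))
      ⊕ constant ((5 + k) * (b⁺′ * b⁺′)) ⊗ (X ⊗ (X ⊗ (X ⊗ (X ⊗ (Y ⊗ (Y ⊗ tail m))))))}
    (≈-cong (λ _ → refl) (λ ℓ → e (5 + k) b⁺ b⁺′ (X ℓ) (Y ℓ) (W m ℓ)) (≈-scalar (5 + k) (reweight {13} {13} {k} (≈-* fB⁺ fB⁺))))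
    (≈-+ (≈-scalar ((5 + k) * (2 * (b⁺ * b⁺′))) (≈-* X≈X Y⁴T))
      (≈-scalar ((5 + k) * (b⁺′ * b⁺′)) (≈-* X≈X (≈-* X≈X (≈-* X≈X (≈-* X≈X Y²T)))))))
    where
    e : ∀ n b b′ x y w → let q = b * (x * x * (y * (y * (y * w)))) + b′ * (x * (x * (x * (x * x))) * (y * w)) in
      n * (q * q) ≡
      0 + n * (b * b) * (x * (x * x) * (x * (y * (y * (y * (y * (y * (y * (w * w))))))))) +
      x * (x * (x * (x * (x * x)))) * (n * (2 * (b * b′)) * (x * (y * (y * (y * (y * (w * w)))))) + n * (b′ * b′) * (x * (x * (x * (x * (y * (y * (w * w))))))))
    e = solve-∀

  neighbours₁ : Neighbours (4 + k) ≈⟨ 26 + (k + k) , (4 + k) * (a * c⁺) , (4 + k) * (a * c⁺′ + a′ * c⁺) ⟩ Q₁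
  neighbours₁ = two-terms (drop-X⁶ {r = constant ((4 + k) * (a′ * c⁺′)) ⊗ (X ⊗ (Y ⊗ (Y ⊗ (Y ⊗ (Y ⊗ tail m)))))}
    (≈-cong (λ _ → refl) (λ ℓ → e (4 + k) a a′ c⁺ c⁺′ (X ℓ) (Y ℓ) (W m ℓ)) (≈-scalar (4 + k) (reweight {12} {14} {k} (≈-* fA fC⁺))))
    (≈-scalar ((4 + k) * (a′ * c⁺′)) (≈-* X≈X Y⁴T)))
    where
    e : ∀ n a a′ c c′ x y w → let p = a * (y * (y * (y * (y * w)))) + a′ * (x * (x * x) * (y * (y * w)))
                                  q = c * (x * (y * (y * (y * (y * w))))) + c′ * (x * (x * (x * x)) * (y * (y * w))) in
      n * (p * q) ≡
      n * (a * c) * (y * y * (x * (y * (y * (y * (y * (y * (y * (w * w))))))))) +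
      n * (a * c′ + a′ * c) * (x * (x * x) * (x * (y * (y * (y * (y * (y * (y * (w * w))))))))) +
      x * (x * (x * (x * (x * x)))) * (n * (a′ * c′) * (x * (y * (y * (y * (y * (w * w)))))))
    e = solve-∀

  square₂ : Square (2 + k) ≈⟨ 22 + (k + k) , (3 + k) * (c * c) , (3 + k) * (2 * (c * c′)) ⟩ Q₂
  square₂ = two-terms (drop-X⁶ {r = constant ((3 + k) * (c′ * c′)) ⊗ (X ⊗ (X ⊗ (Y ⊗ (Y ⊗ tail m))))}
    (≈-cong (λ _ → refl) (λ ℓ → e (3 + k) c c′ (X ℓ) (Y ℓ) (W m ℓ)) (≈-scalar (3 + k) (reweight {11} {11} {k} (≈-* fC fC))))
    (≈-scalar ((3 + k) * (c′ * c′)) (≈-* X≈X (≈-* X≈X Y²T))))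
    where
    e : ∀ n c c′ x y w → let p = c * (x * (y * (y * (y * w)))) + c′ * (x * (x * (x * x)) * (y * w)) in
      n * (p * p) ≡
      n * (c * c) * (y * y * (x * (x * (y * (y * (y * (y * (w * w)))))))) +
      n * (2 * (c * c′)) * (x * (x * x) * (x * (x * (y * (y * (y * (y * (w * w)))))))) +
      x * (x * (x * (x * (x * x)))) * (n * (c′ * c′) * (x * (x * (y * (y * (w * w))))))
    e = solve-∀

  neighbours₂ : Neighbours (2 + k) ≈⟨ 22 + (k + k) , (2 + k) * (b * a) , (2 + k) * (b * a′ + b′ * a) ⟩ Q₂
  neighbours₂ = two-terms (drop-X⁶ {r = constant ((2 + k) * (b′ * a′)) ⊗ (X ⊗ (X ⊗ (Y ⊗ (Y ⊗ tail m))))}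
    (≈-cong (λ _ → refl) (λ ℓ → e (2 + k) b b′ a a′ (X ℓ) (Y ℓ) (W m ℓ)) (≈-scalar (2 + k) (reweight {10} {12} {k} (≈-* fB fA))))
    (≈-scalar ((2 + k) * (b′ * a′)) (≈-* X≈X (≈-* X≈X Y²T))))
    where
    e : ∀ n b b′ a a′ x y w → let p = b * (x * x * (y * (y * w))) + b′ * (x * (x * (x * (x * x))) * w)
                                  q = a * (y * (y * (y * (y * w)))) + a′ * (x * (x * x) * (y * (y * w))) in
      n * (p * q) ≡
      n * (b * a) * (y * y * (x * (x * (y * (y * (y * (y * (w * w)))))))) +
      n * (b * a′ + b′ * a) * (x * (x * x) * (x * (x * (y * (y * (y * (y * (w * w)))))))) +
      x * (x * (x * (x * (x * x)))) * (n * (b′ * a′) * (x * (x * (y * (y * (w * w))))))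
    e = solve-∀

  -- The neighbours contribute X and X², so their product begins at the smaller monomial, while the
  -- square begins at the larger one.
  case₀ : Cofinitely (λ ℓ → Neighbours (3 + k) ℓ < Square (3 + k) ℓ)
  case₀ = ≈⟨⟩-compare neighbours₀ square₀ (inj₁ (*-mono-< {0} {4 + k} (s≤s z≤n) (*-mono-< (α₀>0 (suc m)) (α₀>0 (suc m))))) error₀

  -- The roles are reversed: the square contributes X⁴, the neighbours 1 and X.
  case₁ : Cofinitely (λ ℓ → Square (4 + k) ℓ < Neighbours (4 + k) ℓ)
  case₁ = ≈⟨⟩-compare square₁ neighbours₁ (inj₁ (*-mono-< {0} {4 + k} (s≤s z≤n)
    (*-mono-< (α₀>0 (suc m)) (subst (0 <_) (sym (γ₀≡α₀ (suc m))) (α₀>0 (2 + m)))))) error₁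

  -- Both leading coefficients are multiples of a²: 2 (3m + 2) b a = 7m a² against 2 (3m + 3) c² = 6 (m + 1) a².
  2square : 2 * ((3 + k) * (c * c)) ≡ 6 * suc m * (a * a)
  2square = trans (cong (λ g → 2 * ((3 + k) * (g * g))) (γ₀≡α₀ m)) (e m a)
    where
    e : ∀ m a → 2 * ((3 + m * 3) * (a * a)) ≡ 6 * suc m * (a * a)
    e = solve-∀

  2neighbours : 2 * ((2 + k) * (b * a)) ≡ 7 * m * (a * a)
  2neighbours = trans (e m b a) (trans (cong (_* a) (2[3m+2]β₀ m)) (*-assoc (7 * m) a a))
    where
    e : ∀ m b a → 2 * ((2 + m * 3) * (b * a)) ≡ 2 * ((2 + m * 3) * b) * a
    e = solve-∀

  private
    instance
      a²≢0 : NonZero (a * a)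
      a²≢0 = >-nonZero (*-mono-< (α₀>0 (suc m)) (α₀>0 (suc m)))

  case₂-tie : (3 + k) * (c * c) ≡ (2 + k) * (b * a) → (3 + k) * (2 * (c * c′)) < (2 + k) * (b * a′ + b′ * a) →
    Cofinitely (λ ℓ → Square (2 + k) ℓ < Neighbours (2 + k) ℓ)
  case₂-tie e lt = ≈⟨⟩-compare square₂ neighbours₂ (inj₂ (e , lt)) error₂

  case₂-small : m < 6 → Cofinitely (λ ℓ → Neighbours (2 + k) ℓ < Square (2 + k) ℓ)
  case₂-small m<6 = ≈⟨⟩-compare neighbours₂ square₂ (inj₁ (*-cancelˡ-< 2 _ _
    (subst₂ _<_ (sym 2neighbours) (sym 2square) (*-monoˡ-< (a * a) lt)))) error₂
    where
    open ≤-Reasoning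
    lt : 7 * m < 6 * suc m
    lt = begin-strict
      7 * m      ≡⟨ +-comm m (6 * m) ⟩
      6 * m + m  <⟨ +-monoʳ-< (6 * m) m<6 ⟩
      6 * m + 6  ≡⟨ +-comm (6 * m) 6 ⟩
      6 + 6 * m  ≡⟨ *-suc 6 m ⟨
      6 * suc m  ∎

  case₂-large : 6 < m → Cofinitely (λ ℓ → Square (2 + k) ℓ < Neighbours (2 + k) ℓ)
  case₂-large 6<m = ≈⟨⟩-compare square₂ neighbours₂ (inj₁ (*-cancelˡ-< 2 _ _
    (subst₂ _<_ (sym 2square) (sym 2neighbours) (*-monoˡ-< (a * a) lt)))) error₂
    where
    open ≤-Reasoning
    lt : 6 * suc m < 7 * m
    lt = begin-strict
      6 * suc m  ≡⟨ *-suc 6 m ⟩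
      6 + 6 * m  <⟨ +-monoˡ-< (6 * m) 6<m ⟩
      m + 6 * m  ∎

-- At n = 20 the leading coefficients agree and the second ones decide.
case₂-20 : Cofinitely (λ ℓ → Square (2 + 6 * 3) ℓ < Neighbours (2 + 6 * 3) ℓ)
case₂-20 = case₂-tie 6 refl (toWitness {a? = _ <? _} _)

case₂-from-20 : ∀ m → 6 ≤ m → Cofinitely (λ ℓ → Square (2 + m * 3) ℓ < Neighbours (2 + m * 3) ℓ)
case₂-from-20 m le with m≤n⇒m<n∨m≡n le
... | inj₁ 6<m  = case₂-large m 6<m
... | inj₂ 6≡m  = subst (λ m → Cofinitely (λ ℓ → Square (2 + m * 3) ℓ < Neighbours (2 + m * 3) ℓ)) 6≡m case₂-20

-- From the products of counts to the sign of Δ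

private
  y³ : ℕ → ℕ
  y³ ℓ = Y ℓ * (Y ℓ * Y ℓ)

  factor : ℕ → ℕ → ℕ
  factor p ℓ = (2 + p) * (y³ ℓ * suc p ! * (y³ ℓ * suc p !))

  square≡ : ∀ p ℓ → Square (suc p) ℓ ≡ factor p ℓ * (N ℓ (suc p) * N ℓ (suc p))
  square≡ p ℓ = e (2 + p) (y³ ℓ) (suc p !) (N ℓ (suc p))
    where
    e : ∀ s y f u → s * (y * (f * u) * (y * (f * u))) ≡ s * (y * f * (y * f)) * (u * u)
    e = solve-∀

  neighbours≡ : ∀ p ℓ → Neighbours (suc p) ℓ ≡ factor p ℓ * (N ℓ p * N ℓ (2 + p))
  neighbours≡ p ℓ = e (suc p) (2 + p) (y³ ℓ) (p !) (N ℓ p) (N ℓ (2 + p))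
    where
    e : ∀ n s y f u v → n * (y * (f * u) * (y * (s * (n * f) * v))) ≡ s * (y * (n * f) * (y * (n * f))) * (u * v)
    e = solve-∀

<⇒Δ<0 : ∀ p → Cofinitely (λ ℓ → Square (suc p) ℓ < Neighbours (suc p) ℓ) → Cofinitely (λ ℓ → Δ ℓ (suc p) ℤ.< 0ℤ)
<⇒Δ<0 p = mapᶜ λ ℓ lt → subst (ℤ._< 0ℤ) (sym (ℤP.m-n≡m⊖n (N ℓ (suc p) * N ℓ (suc p)) (N ℓ p * N ℓ (2 + p))))
  (subst (N ℓ (suc p) * N ℓ (suc p) ℤ.⊖ N ℓ p * N ℓ (2 + p) ℤ.<_) (ℤP.n⊖n≡0 (N ℓ p * N ℓ (2 + p)))
    (ℤP.⊖-monoˡ-< (N ℓ p * N ℓ (2 + p)) (*-cancelˡ-< (factor p ℓ) _ _ (subst₂ _<_ (square≡ p ℓ) (neighbours≡ p ℓ) lt))))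

>⇒0≤Δ : ∀ p → Cofinitely (λ ℓ → Neighbours (suc p) ℓ < Square (suc p) ℓ) → Cofinitely (λ ℓ → 0ℤ ℤ.≤ Δ ℓ (suc p))
>⇒0≤Δ p = mapᶜ λ ℓ lt → ℤP.i≤j⇒0≤j-i (ℤ.+≤+
  (<⇒≤ (*-cancelˡ-< (factor p ℓ) _ _ (subst₂ _<_ (neighbours≡ p ℓ) (square≡ p ℓ) lt))))

residue : ∀ n r → n % 3 ≡ r → n ≡ r + n / 3 * 3
residue n r e = trans (m≡m%n+[m/n]*n n 3) (cong (_+ n / 3 * 3) e)

multiple-of-3 : ∀ k → 2 ≤ k * 3 → Cofinitely (λ ℓ → 0ℤ ℤ.≤ Δ ℓ (k * 3))
multiple-of-3 (suc m) _ = >⇒0≤Δ (2 + m * 3) (case₀ m)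

residue-1 : ∀ k → 2 ≤ 1 + k * 3 → Cofinitely (λ ℓ → Δ ℓ (1 + k * 3) ℤ.< 0ℤ)
residue-1 zero    (s≤s ())
residue-1 (suc m) _ = <⇒Δ<0 (3 + m * 3) (case₁ m)

residue-2-small : ∀ k → 2 + k * 3 < 20 → Cofinitely (λ ℓ → 0ℤ ℤ.≤ Δ ℓ (2 + k * 3))
residue-2-small k lt = >⇒0≤Δ (1 + k * 3) (case₂-small k (*-cancelʳ-< 3 k 6 (+-cancelˡ-< 2 (k * 3) 18 lt)))

residue-2-large : ∀ k → 20 ≤ 2 + k * 3 → Cofinitely (λ ℓ → Δ ℓ (2 + k * 3) ℤ.< 0ℤ)
residue-2-large k le = <⇒Δ<0 (1 + k * 3) (case₂-from-20 k (*-cancelʳ-≤ 6 k 3 (+-cancelˡ-≤ 2 18 (k * 3) le)))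

theorem1p2 : (n : ℕ) → 2 ≤ n →
    ((n % 3 ≡ 0 → Cofinitely (λ ℓ → 0ℤ ℤ.≤ Δ ℓ n))
    × (n % 3 ≡ 1 → Cofinitely (λ ℓ → Δ ℓ n ℤ.< 0ℤ))
    × (n % 3 ≡ 2 → n < 20 → Cofinitely (λ ℓ → 0ℤ ℤ.≤ Δ ℓ n))
    × (n % 3 ≡ 2 → 20 ≤ n → Cofinitely (λ ℓ → Δ ℓ n ℤ.< 0ℤ)))
theorem1p2 n 2≤n =
  (λ e → subst (λ n → Cofinitely (λ ℓ → 0ℤ ℤ.≤ Δ ℓ n)) (sym (residue n 0 e))
    (multiple-of-3 (n / 3) (subst (2 ≤_) (residue n 0 e) 2≤n))) ,
  (λ e → subst (λ n → Cofinitely (λ ℓ → Δ ℓ n ℤ.< 0ℤ)) (sym (residue n 1 e))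
    (residue-1 (n / 3) (subst (2 ≤_) (residue n 1 e) 2≤n))) ,
  (λ e lt → subst (λ n → Cofinitely (λ ℓ → 0ℤ ℤ.≤ Δ ℓ n)) (sym (residue n 2 e))
    (residue-2-small (n / 3) (subst (_< 20) (residue n 2 e) lt))) ,
  (λ e le → subst (λ n → Cofinitely (λ ℓ → Δ ℓ n ℤ.< 0ℤ)) (sym (residue n 2 e))
    (residue-2-large (n / 3) (subst (20 ≤_) (residue n 2 e) le)))
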